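{- (i) Let $(T,R)$ be a time frame. Then $([0,1]^T;f_R,f_{R^{ -1}})$, where $[0,1]^T$ is the power of the standard Pavelka algebra, is a tense Pavelka algebra. (ii) Let $(\mathbf A,G,H)$ be a tense Pavelka algebra whose underlying Pavelka algebra $\mathbf A$ is semisimple. Then, with $T=\mathrm{Spec_M}\mathbf A$ and $R(F,F')=\bigwedge_{a\in A}(G(a)/F'\rightarrow a/F)$ for $F,F'\in T$, the natural embedding $n_{\mathbf A}\colon A\to[0,1]^T$ is an injective homomorphism of Pavelka algebras satisfying $n_{\mathbf A}(G(x))=f_R(n_{\mathbf A}(x))$ and $n_{\mathbf A}(H(x))=f_{R^{ -1}}(n_{\mathbf A}(x))$ for all $x\in A$; i.e. $(\mathbf A,G,H)$ embeds into the tense Pavelka algebra induced by the time frame $(T,R)$.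
   Context: An MV-algebra $(A;\oplus,\neg,0)$ carries derived operations $1=\neg0$, $x\cdot y=\neg(\neg x\oplus\neg y)$, $x\rightarrow y=\neg x\oplus y$, $x\vee y=\neg(\neg x\oplus y)\oplus y$, $x\wedge y=\neg(\neg x\vee\neg y)$, order $x\le y$ iff $\neg x\oplus y=1$. The standard MV-algebra is $[0,1]$ with $x\oplus y=\min\{x+y,1\}$, $\neg x=1-x$. A Pavelka algebra is $\mathbf A=(A;\oplus,\neg,\{\mathbf r\mid r\in[0,1]\cap\mathbb Q\})$ with $(A;\oplus,\neg,\mathbf 0)$ an MV-algebra, $\mathbf r\oplus\mathbf s=\mathbf t$ whenever $\min\{r+s,1\}=t$, $\neg\mathbf r=\mathbf s$ whenever $1-r=s$. The standard Pavelka algebra is $[0,1]$ with $\mathbf r$ interpreted as $r$; $[0,1]^T$ is its power. Filters are filters of the MV-reduct; $\mathrm{Spec_M}\mathbf A$ is the set of maximal proper filters; $\mathbf A/F$ embeds uniquely into $[0,1]$ and $x/F$ is identified with its image. Semisimple: MV-reduct is a subdirect product of simple MV-algebras. Natural embedding $n_{\mathbf A}(x)(F)=x/F$. A tense Pavelka algebra is $(\mathbf A,G,H)$ with $\mathbf A$ a Pavelka algebra and $G,H\colon A\to A$ such that for all $x,y\in A$ and all constants $\mathbf r$: (PT1) $G(x\wedge y)=G(x)\wedge G(y)$, $H(x\wedge y)=H(x)\wedge H(y)$; (PT2) $\mathbf r\rightarrow G(x)=G(\mathbf r\rightarrow x)$, $\mathbf r\rightarrow H(x)=H(\mathbf r\rightarrow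 x)$; (PT3) $\neg H(\neg G(x))\le x$ and $\neg G(\neg H(x))\le x$. A time frame is a pair $(T,R)$ with $T$ a set and $R\colon T\times T\to[0,1]$; $R^{ -1}(s,t)=R(t,s)$. For $S\colon T\times T\to[0,1]$, $f_S\colon[0,1]^T\to[0,1]^T$, $f_S(x)(t)=\bigwedge_{s\in T}(S(s,t)\rightarrow x(s))$. -}

module Defs where

import Algebra.Properties.Group as GroupProperties
open import Algebra.Structures using (IsCommutativeMonoid)
open import Data.Product using (Σ-syntax; ∃; ∃-syntax; _×_; _,_; proj₁; proj₂; swap)
open import Data.Rational as ℚ using (ℚ; 0ℚ; 1ℚ)
import Data.Rational.Properties as ℚ
import Data.Rational.Solver
open import Data.Sum using (_⊎_; inj₁; inj₂)
open import Function.Base using (_∘_; id; flip)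
open import Function.Bundles using (Func; _⟨$⟩_)
open import Function.Definitions using (Congruent; Injective; Surjective)
open import Level using (Level; Lift; lift; lower; _⊔_; suc)
open import Relation.Binary.Bundles using (Setoid; Poset)
open import Relation.Binary.Core using (Rel)
open import Relation.Binary.PropositionalEquality as ≡ using (_≡_; refl; sym; trans; subst)
open import Relation.Binary.Structures using (IsEquivalence)
open import Relation.Nullary using (¬_)
open import Relation.Unary using (Pred; _∈_; _∉_; _⊆_; _≐_)

-- The mathematics is classical: existence of maximal filters needs Zorn's
-- lemma, which is to be assumed alongside Axiom.ExcludedMiddle.  The chain C
-- may be empty, so the hypothesis includes that P is inhabited.

Zorn : ∀ c ℓ₁ ℓ₂ p → Set (suc (c ⊔ ℓ₁ ⊔ ℓ₂ ⊔ p))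
Zorn c ℓ₁ ℓ₂ p =
  (P : Poset c ℓ₁ ℓ₂) → let open Poset P in
  ((C : Pred Carrier p) →
   (∀ {x y} → x ∈ C → y ∈ C → x ≤ y ⊎ y ≤ x) →
   ∃[ u ] (∀ {x} → x ∈ C → x ≤ u)) →
  ∃[ m ] (∀ {x} → m ≤ x → x ≤ m)

-- Classical (lower) Dedekind cuts: nonempty proper initial segments of ℚ
-- without a largest element.  Without excluded middle these would only be
-- lower reals.  The level u bounds the size of the index sets over which
-- infima can be formed.

record ℝ (u : Level) : Set (suc u) where
  field
    below     : Pred ℚ u
    inhabited : ∃[ q ] q ∈ below
    bounded   : ∃[ q ] q ∉ below
    downward  : ∀ {p q} → p ℚ.< q → q ∈ below → p ∈ below
    rounded   : ∀ {q} → q ∈ below → ∃[ r ] q ℚ.< r × r ∈ below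

  below⇒<bound : ∀ {p q} → p ∈ below → q ∉ below → p ℚ.< q
  below⇒<bound {p} {q} p∈ q∉ = ℚ.≰⇒> λ q≤p →
    let r , p<r , r∈ = rounded p∈ in q∉ (downward (ℚ.≤-<-trans q≤p p<r) r∈)

open ℝ using (below)

infix 4 _≤ᴿ_

_≤ᴿ_ : ∀ {u} → ℝ u → ℝ u → Set u
x ≤ᴿ y = below x ⊆ below y

private
  q-1<q : ∀ q → q ℚ.- 1ℚ ℚ.< q
  q-1<q q = subst (q ℚ.- 1ℚ ℚ.<_) (ℚ.+-identityʳ q)
    (ℚ.+-monoʳ-< q (ℚ.negative⁻¹ (ℚ.- 1ℚ)))

  q<q+1 : ∀ q → q ℚ.< q ℚ.+ 1ℚ
  q<q+1 q = subst (ℚ._< q ℚ.+ 1ℚ) (ℚ.+-identityʳ q)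
    (ℚ.+-monoʳ-< q (ℚ.positive⁻¹ 1ℚ))

  neg-neg : ∀ q → ℚ.- (ℚ.- q) ≡ q
  neg-neg = GroupProperties.⁻¹-involutive ℚ.+-0-group

  ⊓-glb-< : ∀ {q a b} → q ℚ.< a → q ℚ.< b → q ℚ.< a ℚ.⊓ b
  ⊓-glb-< {q} {a} {b} q<a q<b with ℚ.⊓-sel a b
  ... | inj₁ a⊓b≡a = subst (q ℚ.<_) (sym a⊓b≡a) q<a
  ... | inj₂ a⊓b≡b = subst (q ℚ.<_) (sym a⊓b≡b) q<b

fromℚ : ∀ {u} → ℚ → ℝ u
fromℚ {u} q = record
  { below     = λ p → Lift u (p ℚ.< q)
  ; inhabited = q ℚ.- 1ℚ , lift (q-1<q q)
  ; bounded   = q , λ (lift q<q) → ℚ.<-irrefl refl q<q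
  ; downward  = λ p<r (lift r<q) → lift (ℚ.<-trans p<r r<q)
  ; rounded   = λ (lift p<q) → let r , p<r , r<q = ℚ.<-dense p<q in r , p<r , lift r<q
  }

infixl 6 _+ᴿ_
infix  8 -ᴿ_
infixl 7 _⊓ᴿ_

_+ᴿ_ : ∀ {u} → ℝ u → ℝ u → ℝ u
x +ᴿ y = record
  { below     = λ q → ∃[ a ] ∃[ b ] a ∈ below x × b ∈ below y × q ℚ.< a ℚ.+ b
  ; inhabited = let a , a∈ = X.inhabited ; b , b∈ = Y.inhabited in
                (a ℚ.+ b) ℚ.- 1ℚ , a , b , a∈ , b∈ , q-1<q (a ℚ.+ b)
  ; bounded   = let c , c∉ = X.bounded ; d , d∉ = Y.bounded in
                c ℚ.+ d , λ (a , b , a∈ , b∈ , c+d<a+b) →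
                ℚ.<-asym c+d<a+b
                  (ℚ.+-mono-< (X.below⇒<bound a∈ c∉) (Y.below⇒<bound b∈ d∉))
  ; downward  = λ p<q (a , b , a∈ , b∈ , q<a+b) → a , b , a∈ , b∈ , ℚ.<-trans p<q q<a+b
  ; rounded   = λ (a , b , a∈ , b∈ , q<a+b) →
                let r , q<r , r<a+b = ℚ.<-dense q<a+b in
                r , q<r , a , b , a∈ , b∈ , r<a+b
  }
  where
  module X = ℝ x
  module Y = ℝ y

-- q < - x iff x ≤ - r for some r > q.

-ᴿ_ : ∀ {u} → ℝ u → ℝ u
-ᴿ x = record
  { below     = λ q → ∃[ r ] q ℚ.< r × ℚ.- r ∉ below x
  ; inhabited = let c , c∉ = X.bounded in
                ℚ.- c ℚ.- 1ℚ , ℚ.- c , q-1<q (ℚ.- c) ,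
                subst (_∉ below x) (sym (neg-neg c)) c∉
  ; bounded   = let a , a∈ = X.inhabited in
                ℚ.- a , λ (r , -a<r , -r∉) →
                -r∉ (X.downward (subst (ℚ.- r ℚ.<_) (neg-neg a) (ℚ.neg-antimono-< -a<r)) a∈)
  ; downward  = λ p<q (r , q<r , -r∉) → r , ℚ.<-trans p<q q<r , -r∉
  ; rounded   = λ (r , q<r , -r∉) →
                let s , q<s , s<r = ℚ.<-dense q<r in s , q<s , r , s<r , -r∉
  }
  where module X = ℝ x

_⊓ᴿ_ : ∀ {u} → ℝ u → ℝ u → ℝ u
x ⊓ᴿ y = record
  { below     = λ q → q ∈ below x × q ∈ below y
  ; inhabited = let a , a∈ = X.inhabited ; b , b∈ = Y.inhabited in
                (a ℚ.⊓ b) ℚ.- 1ℚ ,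
                X.downward (ℚ.<-≤-trans (q-1<q (a ℚ.⊓ b)) (ℚ.p⊓q≤p a b)) a∈ ,
                Y.downward (ℚ.<-≤-trans (q-1<q (a ℚ.⊓ b)) (ℚ.p⊓q≤q a b)) b∈
  ; bounded   = let c , c∉ = X.bounded in c , c∉ ∘ proj₁
  ; downward  = λ p<q (q∈x , q∈y) → X.downward p<q q∈x , Y.downward p<q q∈y
  ; rounded   = λ {q} (q∈x , q∈y) →
                let a , q<a , a∈ = X.rounded q∈x
                    b , q<b , b∈ = Y.rounded q∈y
                    m , q<m , m<a⊓b = ℚ.<-dense (⊓-glb-< {q} {a} {b} q<a q<b)
                in m , q<m ,
                   X.downward (ℚ.<-≤-trans m<a⊓b (ℚ.p⊓q≤p a b)) a∈ ,
                   Y.downward (ℚ.<-≤-trans m<a⊓b (ℚ.p⊓q≤q a b)) b∈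
  }
  where
  module X = ℝ x
  module Y = ℝ y

record 𝕀 (u : Level) : Set (suc u) where
  constructor mk𝕀
  field
    real : ℝ u
    0≤   : fromℚ 0ℚ ≤ᴿ real
    ≤1   : real ≤ᴿ fromℚ 1ℚ


open 𝕀 using (real)

infix 4 _≤ᴵ_ _≈ᴵ_

_≤ᴵ_ _≈ᴵ_ : ∀ {u} → 𝕀 u → 𝕀 u → Set u
x ≤ᴵ y = real x ≤ᴿ real y
x ≈ᴵ y = x ≤ᴵ y × y ≤ᴵ x

𝕀-setoid : ∀ u → Setoid (suc u) u
𝕀-setoid u = record
  { Carrier       = 𝕀 u
  ; _≈_           = _≈ᴵ_
  ; isEquivalence = record
    { refl  = id , id
    ; sym   = swap
    ; trans = λ (x≤y , y≤x) (y≤z , z≤y) → y≤z ∘ x≤y , y≤x ∘ z≤y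
    }
  }

record 𝕀ℚ : Set where
  field
    value   : ℚ
    0≤value : 0ℚ ℚ.≤ value
    value≤1 : value ℚ.≤ 1ℚ

open 𝕀ℚ using (value)

0𝕀ℚ : 𝕀ℚ
0𝕀ℚ = record { value = 0ℚ ; 0≤value = ℚ.≤-refl ; value≤1 = ℚ.nonNegative⁻¹ 1ℚ }

constᴵ : ∀ {u} → 𝕀ℚ → 𝕀 u
constᴵ r = record
  { real = fromℚ (value r)
  ; 0≤   = λ (lift q<0) → lift (ℚ.<-≤-trans q<0 (𝕀ℚ.0≤value r))
  ; ≤1   = λ (lift q<r) → lift (ℚ.<-≤-trans q<r (𝕀ℚ.value≤1 r))
  }

infixl 6 _⊕ᴵ_
infix  8 ∼ᴵ_

private
  p-r+r≡p : ∀ p r → p ℚ.- r ℚ.+ r ≡ p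
  p-r+r≡p p r = trans (ℚ.+-assoc p (ℚ.- r) r)
    (trans (≡.cong (p ℚ.+_) (ℚ.+-inverseˡ r)) (ℚ.+-identityʳ p))

  below-0ᴵ : ∀ {u} (x : 𝕀 u) {q} → q ℚ.< 0ℚ → q ∈ below (real x)
  below-0ᴵ x q<0 = 𝕀.0≤ x (lift q<0)

_⊕ᴵ_ : ∀ {u} → 𝕀 u → 𝕀 u → 𝕀 u
x ⊕ᴵ y = record
  { real = (real x +ᴿ real y) ⊓ᴿ fromℚ 1ℚ
  ; 0≤   = λ {q} (lift q<0) →
           let r , q<r , r<0 = ℚ.<-dense q<0
               q-r<0 = subst (q ℚ.- r ℚ.<_) (ℚ.+-inverseʳ r) (ℚ.+-monoˡ-< (ℚ.- r) q<r)
               s , q-r<s , s<0 = ℚ.<-dense q-r<0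
           in (s , r , below-0ᴵ x s<0 , below-0ᴵ y r<0 ,
               subst (ℚ._< s ℚ.+ r) (p-r+r≡p q r) (ℚ.+-monoˡ-< r q-r<s)) ,
              lift (ℚ.<-trans q<0 (ℚ.positive⁻¹ 1ℚ))
  ; ≤1   = proj₂
  }

∼ᴵ_ : ∀ {u} → 𝕀 u → 𝕀 u
∼ᴵ x = record
  { real = fromℚ 1ℚ +ᴿ -ᴿ real x
  ; 0≤   = λ {q} (lift q<0) →
           let r , q<r , r<0 = ℚ.<-dense q<0
               s , r<s , s<0 = ℚ.<-dense r<0
           in 1ℚ ℚ.+ (r ℚ.- s) , s ℚ.- 1ℚ ,
              lift (subst (1ℚ ℚ.+ (r ℚ.- s) ℚ.<_) (ℚ.+-identityʳ 1ℚ)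
                (ℚ.+-monoʳ-< 1ℚ
                  (subst (r ℚ.- s ℚ.<_) (ℚ.+-inverseʳ s) (ℚ.+-monoˡ-< (ℚ.- s) r<s)))) ,
              (ℚ.- 1ℚ , subst (s ℚ.- 1ℚ ℚ.<_) (ℚ.+-identityˡ (ℚ.- 1ℚ)) (ℚ.+-monoˡ-< (ℚ.- 1ℚ) s<0) ,
               λ 1∈ → ℚ.<-irrefl refl (lower (𝕀.≤1 x 1∈))) ,
              subst (q ℚ.<_) (sym (1+[r-s]+[s-1]≡r r s)) q<r
  ; ≤1   = λ {q} (a , b , lift a<1 , (r , b<r , -r∉) , q<a+b) →
           let r≤0 = ℚ.≮⇒≥ {0ℚ} {r} λ 0<r → -r∉ (below-0ᴵ x (ℚ.neg-antimono-< {0ℚ} {r} 0<r))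
           in lift (ℚ.<-trans q<a+b
                (subst (a ℚ.+ b ℚ.<_) (ℚ.+-identityʳ 1ℚ)
                  (ℚ.+-mono-< a<1 (ℚ.<-≤-trans b<r r≤0))))
  }
  where
  1+[r-s]+[s-1]≡r : ∀ r s → 1ℚ ℚ.+ (r ℚ.- s) ℚ.+ (s ℚ.- 1ℚ) ≡ r
  1+[r-s]+[s-1]≡r = solve 2 (λ r s → con 1ℚ :+ (r :- s) :+ (s :- con 1ℚ) := r) refl
    where open Data.Rational.Solver.+-*-Solver

-- In [0,1] the infimum of the empty family is 1.

⋀ : ∀ {i u} {I : Set i} → (I → 𝕀 (i ⊔ u)) → 𝕀 (i ⊔ u)
⋀ {I = I} x = record
  { real = record
    { below     = λ q → q ℚ.< 1ℚ × ∃[ r ] q ℚ.< r × (∀ j → r ∈ below (real (x j)))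
    ; inhabited = ℚ.- 1ℚ ℚ.- 1ℚ , <0⇒∈ (ℚ.negative⁻¹ (ℚ.- 1ℚ ℚ.- 1ℚ))
    ; bounded   = 1ℚ , λ (1<1 , _) → ℚ.<-irrefl refl 1<1
    ; downward  = λ p<q (q<1 , r , q<r , r∈) → ℚ.<-trans p<q q<1 , r , ℚ.<-trans p<q q<r , r∈
    ; rounded   = λ {q} (q<1 , r , q<r , r∈) →
                  let s , q<s , s<1 = ℚ.<-dense q<1
                      t , q<t , t<r = ℚ.<-dense q<r
                      s⊓t<1 = ℚ.≤-<-trans (ℚ.p⊓q≤p s t) s<1
                      s⊓t<r = ℚ.≤-<-trans (ℚ.p⊓q≤q s t) t<r
                  in s ℚ.⊓ t , ⊓-glb-< {q} {s} {t} q<s q<t , s⊓t<1 , r , s⊓t<r , r∈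
    }
  ; 0≤   = λ (lift q<0) → <0⇒∈ q<0
  ; ≤1   = λ (q<1 , _) → lift q<1
  }
  where
  <0⇒∈ : ∀ {q} → q ℚ.< 0ℚ → q ℚ.< 1ℚ × ∃[ r ] q ℚ.< r × (∀ j → r ∈ below (real (x j)))
  <0⇒∈ q<0 = let r , q<r , r<0 = ℚ.<-dense q<0 in
    ℚ.<-trans q<0 (ℚ.positive⁻¹ 1ℚ) , r , q<r , λ j → below-0ᴵ (x j) r<0

⋀-lower : ∀ {i u} {I : Set i} (x : I → 𝕀 (i ⊔ u)) j → ⋀ {u = u} x ≤ᴵ x j
⋀-lower x j (_ , r , q<r , r∈) = ℝ.downward (real (x j)) q<r (r∈ j)

⋀-greatest : ∀ {i u} {I : Set i} (x : I → 𝕀 (i ⊔ u)) (y : 𝕀 (i ⊔ u)) →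
             (∀ j → y ≤ᴵ x j) → y ≤ᴵ ⋀ {u = u} x
⋀-greatest x y y≤x q∈ =
  let r , q<r , r∈ = ℝ.rounded (real y) q∈ in
  lower (𝕀.≤1 y q∈) , r , q<r , λ j → y≤x j r∈

-- Negation is written ∼, as ¬ denotes the negation of propositions.

record RawMVAlgebra c ℓ : Set (suc (c ⊔ ℓ)) where
  infix  4 _≈_ _≤_
  infixl 6 _⊕_
  infixl 7 _·_
  infixr 5 _⇒_
  infixl 6 _∨_
  infixl 7 _∧_
  infix  8 ∼_
  field
    Carrier : Set c
    _≈_     : Rel Carrier ℓ
    _⊕_     : Carrier → Carrier → Carrier
    ∼_      : Carrier → Carrier
    0#      : Carrier

  1# : Carrier
  1# = ∼ 0#

  _·_ _⇒_ _∨_ _∧_ : Carrier → Carrier → Carrier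
  x · y = ∼ (∼ x ⊕ ∼ y)
  x ⇒ y = ∼ x ⊕ y
  x ∨ y = ∼ (∼ x ⊕ y) ⊕ y
  x ∧ y = ∼ (∼ x ∨ ∼ y)

  _≤_ : Rel Carrier ℓ
  x ≤ y = ∼ x ⊕ y ≈ 1#

record IsMVAlgebra {c ℓ} (A : RawMVAlgebra c ℓ) : Set (c ⊔ ℓ) where
  open RawMVAlgebra A
  field
    ⊕-isCommutativeMonoid : IsCommutativeMonoid _≈_ _⊕_ 0#
    ∼-cong                : ∀ {x y} → x ≈ y → ∼ x ≈ ∼ y
    ∼-involutive          : ∀ x → ∼ ∼ x ≈ x
    ⊕-zeroʳ               : ∀ x → x ⊕ ∼ 0# ≈ ∼ 0#
    łukasiewicz           : ∀ x y → ∼ (∼ x ⊕ y) ⊕ y ≈ ∼ (∼ y ⊕ x) ⊕ x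

record MVAlgebra c ℓ : Set (suc (c ⊔ ℓ)) where
  field
    raw         : RawMVAlgebra c ℓ
    isMVAlgebra : IsMVAlgebra raw

  open RawMVAlgebra raw public
  open IsMVAlgebra isMVAlgebra public

module _ {a ℓ b m} (A : RawMVAlgebra a ℓ) (B : RawMVAlgebra b m) where
  private
    module A = RawMVAlgebra A
    module B = RawMVAlgebra B

  record IsMVHomomorphism (f : A.Carrier → B.Carrier) : Set (a ⊔ ℓ ⊔ m) where
    field
      cong   : Congruent A._≈_ B._≈_ f
      ⊕-homo : ∀ x y → f (x A.⊕ y) B.≈ f x B.⊕ f y
      ∼-homo : ∀ x → f (A.∼ x) B.≈ B.∼ f x
      0-homo : f A.0# B.≈ B.0#

  record IsMVMonomorphism (f : A.Carrier → B.Carrier) : Set (a ⊔ ℓ ⊔ m) where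
    field
      isMVHomomorphism : IsMVHomomorphism f
      injective        : Injective A._≈_ B._≈_ f

module _ {c ℓ} (A : MVAlgebra c ℓ) where
  open MVAlgebra A

  record IsCongruence {p} (_θ_ : Rel Carrier p) : Set (c ⊔ ℓ ⊔ p) where
    field
      isEquivalence : IsEquivalence _θ_
      reflexive     : ∀ {x y} → x ≈ y → x θ y
      ⊕-compatible  : ∀ {x y z w} → x θ y → z θ w → (x ⊕ z) θ (y ⊕ w)
      ∼-compatible  : ∀ {x y} → x θ y → (∼ x) θ (∼ y)

  -- Classically the universe level of the congruences is immaterial.

  record IsSimple : Set (suc (c ⊔ ℓ)) where
    field
      nontrivial : ¬ (0# ≈ 1#)
      simple     : (_θ_ : Rel Carrier (c ⊔ ℓ)) → IsCongruence _θ_ →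
                   (∀ {x y} → x θ y → x ≈ y) ⊎ (∀ x y → x θ y)

  record SubdirectRepresentation i s sℓ : Set (c ⊔ ℓ ⊔ suc (i ⊔ s ⊔ sℓ)) where
    field
      Index         : Set i
      factor        : Index → MVAlgebra s sℓ
      proj          : ∀ j → Carrier → MVAlgebra.Carrier (factor j)
      proj-isHom    : ∀ j → IsMVHomomorphism raw (MVAlgebra.raw (factor j)) (proj j)
      surjective    : ∀ j → Surjective _≈_ (MVAlgebra._≈_ (factor j)) (proj j)
      jointly-monic : ∀ {x y} → (∀ j → MVAlgebra._≈_ (factor j) (proj j x) (proj j y)) → x ≈ y

module _ {c ℓ} (A : MVAlgebra c ℓ) where
  Semisimple : ∀ i s sℓ → Set (c ⊔ ℓ ⊔ suc (i ⊔ s ⊔ sℓ))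
  Semisimple i s sℓ =
    Σ[ S ∈ SubdirectRepresentation A i s sℓ ]
      (∀ j → IsSimple (SubdirectRepresentation.factor S j))

module _ {c ℓ} (A : RawMVAlgebra c ℓ) where
  open RawMVAlgebra A

  record IsFilter {p} (F : Pred Carrier p) : Set (c ⊔ ℓ ⊔ p) where
    field
      1∈       : 1# ∈ F
      ·-closed : ∀ {x y} → x ∈ F → y ∈ F → x · y ∈ F
      ↑-closed : ∀ {x y} → x ≤ y → x ∈ F → y ∈ F

  record IsProperFilter {p} (F : Pred Carrier p) : Set (c ⊔ ℓ ⊔ p) where
    field
      isFilter : IsFilter F
      0∉       : 0# ∉ F

    open IsFilter isFilter public

  -- Again, classically the level of the predicates is immaterial.

  record MaximalFilter : Set (suc (c ⊔ ℓ)) where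
    field
      member         : Pred Carrier (c ⊔ ℓ)
      isProperFilter : IsProperFilter member
      maximal        : ∀ (F : Pred Carrier (c ⊔ ℓ)) → IsProperFilter F →
                       member ⊆ F → F ⊆ member

  Spec : Setoid (suc (c ⊔ ℓ)) (c ⊔ ℓ)
  Spec = record
    { Carrier       = MaximalFilter
    ; _≈_           = λ F F′ → MaximalFilter.member F ≐ MaximalFilter.member F′
    ; isEquivalence = record
      { refl  = id , id
      ; sym   = swap
      ; trans = λ (F⊆G , G⊆F) (G⊆H , H⊆G) → G⊆H ∘ F⊆G , G⊆F ∘ H⊆G
      }
    }

  -- The quotient of A by a filter: the same carrier with a coarser equality.

  quotient : ∀ {p} → Pred Carrier p → RawMVAlgebra c p
  quotient F = record
    { Carrier = Carrier
    ; _≈_     = λ x y → x ⇒ y ∈ F × y ⇒ x ∈ F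
    ; _⊕_     = _⊕_
    ; ∼_      = ∼_
    ; 0#      = 0#
    }

record RawPavelkaAlgebra c ℓ : Set (suc (c ⊔ ℓ)) where
  infix  4 _≈_
  infixl 6 _⊕_
  infix  8 ∼_
  field
    Carrier : Set c
    _≈_     : Rel Carrier ℓ
    _⊕_     : Carrier → Carrier → Carrier
    ∼_      : Carrier → Carrier
    const   : 𝕀ℚ → Carrier

  rawMVAlgebra : RawMVAlgebra c ℓ
  rawMVAlgebra = record
    { Carrier = Carrier ; _≈_ = _≈_ ; _⊕_ = _⊕_ ; ∼_ = ∼_ ; 0# = const 0𝕀ℚ }

  open RawMVAlgebra rawMVAlgebra public
    using (0#; 1#; _·_; _⇒_; _∨_; _∧_; _≤_)

record IsPavelkaAlgebra {c ℓ} (A : RawPavelkaAlgebra c ℓ) : Set (c ⊔ ℓ) where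
  open RawPavelkaAlgebra A
  field
    isMVAlgebra : IsMVAlgebra rawMVAlgebra
    ⊕-const     : ∀ r s t → (value r ℚ.+ value s) ℚ.⊓ 1ℚ ≡ value t →
                  const r ⊕ const s ≈ const t
    ∼-const     : ∀ r s → 1ℚ ℚ.- value r ≡ value s → ∼ const r ≈ const s

module _ {a ℓ b m} (A : RawPavelkaAlgebra a ℓ) (B : RawPavelkaAlgebra b m) where
  private
    module A = RawPavelkaAlgebra A
    module B = RawPavelkaAlgebra B

  record IsPavelkaHomomorphism (f : A.Carrier → B.Carrier) : Set (a ⊔ ℓ ⊔ m) where
    field
      cong       : Congruent A._≈_ B._≈_ f
      ⊕-homo     : ∀ x y → f (x A.⊕ y) B.≈ f x B.⊕ f y
      ∼-homo     : ∀ x → f (A.∼ x) B.≈ B.∼ f x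
      const-homo : ∀ r → f (A.const r) B.≈ B.const r

standard : ∀ u → RawPavelkaAlgebra (suc u) u
standard u = record
  { Carrier = 𝕀 u
  ; _≈_     = _≈ᴵ_
  ; _⊕_     = _⊕ᴵ_
  ; ∼_      = ∼ᴵ_
  ; const   = constᴵ
  }

⊕ᴵ-mono : ∀ {u} {x y z w : 𝕀 u} → x ≤ᴵ y → z ≤ᴵ w → x ⊕ᴵ z ≤ᴵ y ⊕ᴵ w
⊕ᴵ-mono x≤y z≤w ((a , b , a∈ , b∈ , q<a+b) , q<1) = (a , b , x≤y a∈ , z≤w b∈ , q<a+b) , q<1

∼ᴵ-anti : ∀ {u} {x y : 𝕀 u} → x ≤ᴵ y → ∼ᴵ y ≤ᴵ ∼ᴵ x
∼ᴵ-anti x≤y (a , b , a<1 , (r , b<r , -r∉) , q<a+b) =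
  a , b , a<1 , (r , b<r , -r∉ ∘ x≤y) , q<a+b

⊕ᴵ-cong : ∀ {u} {x y z w : 𝕀 u} → x ≈ᴵ y → z ≈ᴵ w → x ⊕ᴵ z ≈ᴵ y ⊕ᴵ w
⊕ᴵ-cong {x = x} {y} {z} {w} (x≤y , y≤x) (z≤w , w≤z) =
  ⊕ᴵ-mono {x = x} {y} {z} {w} x≤y z≤w , ⊕ᴵ-mono {x = y} {x} {w} {z} y≤x w≤z

∼ᴵ-cong : ∀ {u} {x y : 𝕀 u} → x ≈ᴵ y → ∼ᴵ x ≈ᴵ ∼ᴵ y
∼ᴵ-cong {x = x} {y} (x≤y , y≤x) = ∼ᴵ-anti {x = y} {x} y≤x , ∼ᴵ-anti {x = x} {y} x≤y

⋀-cong : ∀ {i u} {I : Set i} (x y : I → 𝕀 (i ⊔ u)) →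
         (∀ j → x j ≈ᴵ y j) → ⋀ {u = u} x ≈ᴵ ⋀ {u = u} y
⋀-cong {u = u} x y x≈y =
  ⋀-greatest {u = u} y (⋀ {u = u} x) (λ j → proj₁ (x≈y j) ∘ ⋀-lower {u = u} x j) ,
  ⋀-greatest {u = u} x (⋀ {u = u} y) (λ j → proj₂ (x≈y j) ∘ ⋀-lower {u = u} y j)

-- Sets are setoids here, so the power consists of the functions that respect
-- the equality of T.

power : ∀ {t t′} → Setoid t t′ → ∀ u → RawPavelkaAlgebra (t ⊔ t′ ⊔ suc u) (t ⊔ u)
power T u = record
  { Carrier = Func T (𝕀-setoid u)
  ; _≈_     = λ f g → ∀ t → f ⟨$⟩ t ≈ᴵ g ⟨$⟩ t
  ; _⊕_     = λ f g → record
    { to   = λ t → (f ⟨$⟩ t) ⊕ᴵ (g ⟨$⟩ t)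
    ; cong = λ {s} {t} s≈t → ⊕ᴵ-cong {x = f ⟨$⟩ s} {f ⟨$⟩ t} {g ⟨$⟩ s} {g ⟨$⟩ t}
                               (Func.cong f s≈t) (Func.cong g s≈t)
    }
  ; ∼_      = λ f → record
    { to   = λ t → ∼ᴵ (f ⟨$⟩ t)
    ; cong = λ {s} {t} s≈t → ∼ᴵ-cong {x = f ⟨$⟩ s} {f ⟨$⟩ t} (Func.cong f s≈t)
    }
  ; const   = λ r → record { to = λ _ → constᴵ r ; cong = λ _ → id , id }
  }

record RawTensePavelkaAlgebra c ℓ : Set (suc (c ⊔ ℓ)) where
  field
    rawPavelkaAlgebra : RawPavelkaAlgebra c ℓ

  open RawPavelkaAlgebra rawPavelkaAlgebra public

  field
    G H : Carrier → Carrier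

record IsTensePavelkaAlgebra {c ℓ} (A : RawTensePavelkaAlgebra c ℓ) : Set (c ⊔ ℓ) where
  open RawTensePavelkaAlgebra A
  field
    isPavelkaAlgebra : IsPavelkaAlgebra rawPavelkaAlgebra
    G-cong           : Congruent _≈_ _≈_ G
    H-cong           : Congruent _≈_ _≈_ H
    G-∧              : ∀ x y → G (x ∧ y) ≈ G x ∧ G y
    H-∧              : ∀ x y → H (x ∧ y) ≈ H x ∧ H y
    G-⇒              : ∀ r x → (const r ⇒ G x) ≈ G (const r ⇒ x)
    H-⇒              : ∀ r x → (const r ⇒ H x) ≈ H (const r ⇒ x)
    ∼H∼G≤            : ∀ x → ∼ H (∼ G x) ≤ x
    ∼G∼H≤            : ∀ x → ∼ G (∼ H x) ≤ x

  open IsPavelkaAlgebra isPavelkaAlgebra public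

record TensePavelkaAlgebra c ℓ : Set (suc (c ⊔ ℓ)) where
  field
    raw                   : RawTensePavelkaAlgebra c ℓ
    isTensePavelkaAlgebra : IsTensePavelkaAlgebra raw

  open RawTensePavelkaAlgebra raw public
  open IsTensePavelkaAlgebra isTensePavelkaAlgebra public

  mvAlgebra : MVAlgebra c ℓ
  mvAlgebra = record { raw = rawMVAlgebra ; isMVAlgebra = isMVAlgebra }

module _ {a ℓ b m} (A : RawTensePavelkaAlgebra a ℓ) (B : RawTensePavelkaAlgebra b m) where
  private
    module A = RawTensePavelkaAlgebra A
    module B = RawTensePavelkaAlgebra B

  record IsTensePavelkaEmbedding (f : A.Carrier → B.Carrier) : Set (a ⊔ ℓ ⊔ m) where
    field
      isPavelkaHomomorphism : IsPavelkaHomomorphism A.rawPavelkaAlgebra B.rawPavelkaAlgebra f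
      injective             : Injective A._≈_ B._≈_ f
      G-homo                : ∀ x → f (A.G x) B.≈ B.G (f x)
      H-homo                : ∀ x → f (A.H x) B.≈ B.H (f x)

record TimeFrame t t′ : Set (suc (t ⊔ t′)) where
  field
    T      : Setoid t t′
    R      : Setoid.Carrier T → Setoid.Carrier T → 𝕀 t
    R-cong : ∀ {s s′ r r′} → Setoid._≈_ T s s′ → Setoid._≈_ T r r′ → R s r ≈ᴵ R s′ r′

converse : ∀ {t t′} → TimeFrame t t′ → TimeFrame t t′
converse 𝓕 = record { T = T ; R = flip R ; R-cong = flip R-cong }
  where open TimeFrame 𝓕

module _ {t t′} (𝓕 : TimeFrame t t′) where
  open TimeFrame 𝓕
  open RawPavelkaAlgebra (standard t) using (_⇒_)

  f : Func T (𝕀-setoid t) → Func T (𝕀-setoid t)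
  f x = record
    { to   = λ v → ⋀ {u = t} λ s → R s v ⇒ (x ⟨$⟩ s)
    ; cong = λ {v} {w} v≈w →
        ⋀-cong {u = t} (λ s → R s v ⇒ (x ⟨$⟩ s)) (λ s → R s w ⇒ (x ⟨$⟩ s)) λ s →
        ⊕ᴵ-cong {x = ∼ᴵ R s v} {∼ᴵ R s w} {x ⟨$⟩ s} {x ⟨$⟩ s}
          (∼ᴵ-cong {x = R s v} {R s w} (R-cong (Setoid.refl T) v≈w)) (id , id)
    }

induced : ∀ {t t′} → TimeFrame t t′ → RawTensePavelkaAlgebra (suc t ⊔ t′) t
induced {t} 𝓕 = record
  { rawPavelkaAlgebra = power (TimeFrame.T 𝓕) t
  ; G                 = f 𝓕
  ; H                 = f (converse 𝓕)
  }

-- x / F denotes the image of the class of x under the (unique) embedding of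
-- the MV-algebra A/F into [0,1].  /-congʳ only says that the embedding depends
-- on F as a set, which classically follows from uniqueness.

record QuotientEmbeddings {c ℓ} (A : RawMVAlgebra c ℓ) : Set (suc (suc (c ⊔ ℓ))) where
  infix 9 _/_
  open RawMVAlgebra A
  open MaximalFilter using (member)
  private u = suc (c ⊔ ℓ)
  field
    _/_         : Carrier → MaximalFilter A → 𝕀 u
    /-congʳ     : ∀ x {F F′} → member F ≐ member F′ → x / F ≈ᴵ x / F′
    isEmbedding : ∀ F → IsMVMonomorphism (quotient A (member F))
                          (RawPavelkaAlgebra.rawMVAlgebra (standard u)) (_/ F)

module _ {c ℓ} (𝐀 : TensePavelkaAlgebra c ℓ)
         (q : QuotientEmbeddings (TensePavelkaAlgebra.rawMVAlgebra 𝐀)) where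
  open TensePavelkaAlgebra 𝐀 using (Carrier; rawMVAlgebra; G; H)
  open QuotientEmbeddings q
  private u = suc (c ⊔ ℓ)
  open RawPavelkaAlgebra (standard u) using (_⇒_)

  natural : Carrier → Func (Spec rawMVAlgebra) (𝕀-setoid u)
  natural x = record { to = x /_ ; cong = /-congʳ x }

  canonicalFrame : TimeFrame u (c ⊔ ℓ)
  canonicalFrame = record
    { T      = Spec rawMVAlgebra
    ; R      = λ F F′ → ⋀ {u = u} λ a → G a / F′ ⇒ a / F
    ; R-cong = λ {F} {F₁} {F′} {F₁′} F≈ F′≈ →
        ⋀-cong {u = u} (λ a → G a / F′ ⇒ a / F) (λ a → G a / F₁′ ⇒ a / F₁) λ a →
        ⊕ᴵ-cong {x = ∼ᴵ (G a / F′)} {∼ᴵ (G a / F₁′)} {a / F} {a / F₁}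
          (∼ᴵ-cong {x = G a / F′} {G a / F₁′} (/-congʳ (G a) F′≈)) (/-congʳ a F≈)
    }

{-# OPTIONS --safe #-}
module Submission where

-- For (i), □ x t = ⋀ₛ (R s t ⇒ x s) commutes with ∧ and with r ⇒ – by
-- residuation, and the boxes of R and of its converse are adjoint up to ∼.
-- This holds in any MV-algebra having the infima involved.
--
-- For (ii), each A/F embeds into [0,1] by sending x to the supremum of the
-- rationals r with r ⇒ x ∈ F, and a gap-doubling argument shows that every
-- embedding fixes the constants.  Semisimplicity makes the natural embedding
-- injective.  One half of G x / N = ⋀_M (R M N ⇒ x / M) is the definition of R.
-- For the other, let G x / N < r, and put y = r ⇒ x, so that G y ∉ N.  Then x ⇒ r
-- and all y ⇒ b with G b ∈ N lie in a common proper filter, hence by Zorn in a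
-- maximal one, M.  There x / M ≤ r and y / M ≤ R M N, and thus
-- R M N ⇒ x / M ≤ (r ⇒ x / M) ⇒ x / M = r ∨ x / M = r.  Finally (PT3) shows
-- that the relation defined by H is the converse of the one defined by G.

-- The difficulty in (ii) is that a filter only records which elements belong to it, while `R` and
-- the box compare values in [0,1]. (PT2) connects the two: G a / N ≥ s holds exactly when s ⇒ G a,
-- that is G (s ⇒ a), lies in N. On one side this turns G x / N < r into G y ∉ N. On the other it
-- explains y / M ≤ R M N: for every rational s ≤ G a / N, the choice b = s ⇒ a gives y / M ≤ (s ⇒ a
-- / M), and such s come arbitrarily close to G a / N.
--
-- For this the constants must have their intended values in every quotient, although an embedding
-- of A/F is only given as an MV-homomorphism. Gap doubling provides them: a constant r sent above
-- some t > r yields, by repeated doubling or squaring, pairs with larger and larger gaps, until 1 ≤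
-- 0 results.
--
-- The argument runs over an abstract Pavelka algebra whose constants reflect the order and are
-- dense, so cuts enter only when [0,1] is shown to have these properties and when its MV-order is
-- compared with inclusion of cuts.

open import Defs
open import Algebra.Definitions.RawMonoid using () renaming (_×_ to multiple)
open import Algebra.Properties.CommutativeMonoid.Mult using (×-distrib-+)
open import Algebra.Structures using (IsCommutativeMonoid)
open import Axiom.ExcludedMiddle using (ExcludedMiddle)
open import Data.Empty using (⊥)
open import Data.Integer as ℤ using (+_; -[1+_])
import Data.Integer.Properties as ℤ
open import Data.Nat as ℕ using (ℕ)
import Data.Nat.Properties as ℕ
open import Data.Product using (∃-syntax; _×_; _,_; proj₁; proj₂)
open import Data.Rational as ℚ using (ℚ; 0ℚ; 1ℚ; toℚᵘ; mkℚ)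
import Data.Rational.Properties as ℚ
open import Data.Rational.Solver using (module +-*-Solver)
open import Data.Rational.Unnormalised as ℚᵘ using (mkℚᵘ; *≡*; *≤*)
import Data.Rational.Unnormalised.Properties as ℚᵘ
open import Data.Sum using (_⊎_; inj₁; inj₂; [_,_]′; fromInj₁)
open import Function.Base using (_∘_; id)
open import Function.Bundles using (_⟨$⟩_)
open import Function.Definitions using (Congruent)
open import Level using (Level; Lift; lift; lower; _⊔_; suc; 0ℓ)
open import Relation.Binary.Bundles using (Setoid; Preorder; Poset)
open import Relation.Binary.PropositionalEquality as ≡ using (_≡_; refl; subst; subst₂)
import Relation.Binary.Reasoning.Preorder as PreorderReasoning
import Relation.Binary.Reasoning.Setoid as SetoidReasoning
open import Relation.Binary.Structures using (IsEquivalence)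
open import Relation.Nullary using (¬_; yes; no; contradiction)
open import Relation.Nullary.Decidable using (True; toWitness; fromWitness; decidable-stable)
open import Relation.Unary using (Pred; _∈_; _∉_; _⊆_; _≐_)

open +-*-Solver using (solve; _:+_; _:-_; _:=_; con)
open ℝ using (below)
open 𝕀 using (real)
open 𝕀ℚ using (value)

-- MV-algebras

module MVProperties {c ℓ} (A : MVAlgebra c ℓ) where
  open MVAlgebra A
  open IsCommutativeMonoid ⊕-isCommutativeMonoid public
    using (setoid)
    renaming ( refl to ≈-refl; sym to ≈-sym; trans to ≈-trans; isEquivalence to ≈-isEquivalence
             ; ∙-cong to ⊕-cong; ∙-congˡ to ⊕-congˡ; ∙-congʳ to ⊕-congʳ
             ; assoc to ⊕-assoc; comm to ⊕-comm; identityˡ to ⊕-identityˡ; identityʳ to ⊕-identityʳ)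

  private
    variable
      x y z w : Carrier

    x⊕yz≈y⊕xz : ∀ x y z → x ⊕ (y ⊕ z) ≈ y ⊕ (x ⊕ z)
    x⊕yz≈y⊕xz x y z = ≈-trans (≈-sym (⊕-assoc x y z))
      (≈-trans (⊕-congʳ (⊕-comm x y)) (⊕-assoc y x z))

  ∼1≈0 : ∼ 1# ≈ 0#
  ∼1≈0 = ∼-involutive 0#

  -- The Łukasiewicz axiom at `x` and `1#`: one side collapses to `1#`, the other to `∼ x ⊕ x`.
  ⊕-inverseˡ : ∀ x → ∼ x ⊕ x ≈ 1#
  ⊕-inverseˡ x = begin
    ∼ x ⊕ x                 ≈⟨ ⊕-congʳ (∼-cong (⊕-identityˡ x)) ⟨
    ∼ (0# ⊕ x) ⊕ x          ≈⟨ ⊕-congʳ (∼-cong (⊕-congʳ ∼1≈0)) ⟨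
    ∼ (∼ 1# ⊕ x) ⊕ x        ≈⟨ łukasiewicz x 1# ⟨
    ∼ (∼ x ⊕ 1#) ⊕ 1#       ≈⟨ ⊕-zeroʳ _ ⟩
    1#                      ∎
    where open SetoidReasoning setoid

  ⊕-zeroˡ : ∀ x → 1# ⊕ x ≈ 1#
  ⊕-zeroˡ x = ≈-trans (⊕-comm 1# x) (⊕-zeroʳ x)

  ≤⇒∨≈ : x ≤ y → x ∨ y ≈ y
  ≤⇒∨≈ {x} {y} x≤y = begin
    ∼ (∼ x ⊕ y) ⊕ y   ≈⟨ ⊕-congʳ (∼-cong x≤y) ⟩
    ∼ 1# ⊕ y          ≈⟨ ⊕-congʳ ∼1≈0 ⟩
    0# ⊕ y            ≈⟨ ⊕-identityˡ y ⟩
    y                 ∎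
    where open SetoidReasoning setoid

  ∨-comm : ∀ x y → x ∨ y ≈ y ∨ x
  ∨-comm = łukasiewicz

  ≈⇒≤ : x ≈ y → x ≤ y
  ≈⇒≤ {x} {y} x≈y = ≈-trans (⊕-congˡ (≈-sym x≈y)) (⊕-inverseˡ x)

  ≤-refl : x ≤ x
  ≤-refl = ⊕-inverseˡ _

  ≤-antisym : x ≤ y → y ≤ x → x ≈ y
  ≤-antisym {x} {y} x≤y y≤x =
    ≈-trans (≈-sym (≤⇒∨≈ y≤x)) (≈-trans (∨-comm y x) (≤⇒∨≈ x≤y))

  -- Writing `z` as `z ∨ y`, whose defining term ends in `⊕ y`, exposes the summand `∼ x ⊕ y`, which
  -- is `1#`.
  ≤-trans : x ≤ y → y ≤ z → x ≤ z
  ≤-trans {x} {y} {z} x≤y y≤z = begin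
    ∼ x ⊕ z                        ≈⟨ ⊕-congˡ (≤⇒∨≈ y≤z) ⟨
    ∼ x ⊕ (y ∨ z)                  ≈⟨ ⊕-congˡ (∨-comm y z) ⟩
    ∼ x ⊕ (∼ (∼ z ⊕ y) ⊕ y)        ≈⟨ x⊕yz≈y⊕xz _ _ _ ⟩
    ∼ (∼ z ⊕ y) ⊕ (∼ x ⊕ y)        ≈⟨ ⊕-congˡ x≤y ⟩
    ∼ (∼ z ⊕ y) ⊕ 1#               ≈⟨ ⊕-zeroʳ _ ⟩
    1#                             ∎
    where open SetoidReasoning setoid

  ≤-preorder : Preorder c ℓ ℓ
  ≤-preorder = record
    { _≈_ = _≈_ ; _≲_ = _≤_
    ; isPreorder = record
      { isEquivalence = ≈-isEquivalence ; reflexive = ≈⇒≤ ; trans = ≤-trans } }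

  module ≤-Reasoning = PreorderReasoning ≤-preorder

  0≤x : ∀ x → 0# ≤ x
  0≤x = ⊕-zeroˡ

  x≤1 : ∀ x → x ≤ 1#
  x≤1 x = ⊕-zeroʳ (∼ x)

  1≤⇒≈1 : 1# ≤ x → x ≈ 1#
  1≤⇒≈1 1≤x = ≤-antisym (x≤1 _) 1≤x

  x≤y⊕x : ∀ x y → x ≤ y ⊕ x
  x≤y⊕x x y = begin
    ∼ x ⊕ (y ⊕ x)   ≈⟨ x⊕yz≈y⊕xz _ _ _ ⟩
    y ⊕ (∼ x ⊕ x)   ≈⟨ ⊕-congˡ (⊕-inverseˡ x) ⟩
    y ⊕ 1#          ≈⟨ ⊕-zeroʳ y ⟩
    1#              ∎
    where open SetoidReasoning setoid

  -- If `x ≤ y`, then `y` is `x` plus the difference `∼ (∼ y ⊕ x)`, so `z ⊕ y` is `z ⊕ x` plus the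
  -- same difference.
  ⊕-monoʳ-≤ : ∀ z → x ≤ y → z ⊕ x ≤ z ⊕ y
  ⊕-monoʳ-≤ {x} {y} z x≤y = begin
    z ⊕ x                          ≲⟨ x≤y⊕x _ _ ⟩
    ∼ (∼ y ⊕ x) ⊕ (z ⊕ x)          ≈⟨ x⊕yz≈y⊕xz _ _ _ ⟩
    z ⊕ (y ∨ x)                    ≈⟨ ⊕-congˡ (∨-comm y x) ⟩
    z ⊕ (x ∨ y)                    ≈⟨ ⊕-congˡ (≤⇒∨≈ x≤y) ⟩
    z ⊕ y                          ∎
    where open ≤-Reasoning

  ⊕-monoˡ-≤ : ∀ z → x ≤ y → x ⊕ z ≤ y ⊕ z
  ⊕-monoˡ-≤ {x} {y} z x≤y = begin
    x ⊕ z   ≈⟨ ⊕-comm x z ⟩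
    z ⊕ x   ≲⟨ ⊕-monoʳ-≤ z x≤y ⟩
    z ⊕ y   ≈⟨ ⊕-comm z y ⟩
    y ⊕ z   ∎
    where open ≤-Reasoning

  ⊕-mono-≤ : x ≤ y → z ≤ w → x ⊕ z ≤ y ⊕ w
  ⊕-mono-≤ x≤y z≤w = ≤-trans (⊕-monoˡ-≤ _ x≤y) (⊕-monoʳ-≤ _ z≤w)

  ∼-anti-≤ : x ≤ y → ∼ y ≤ ∼ x
  ∼-anti-≤ {x} {y} x≤y = ≈-trans (⊕-comm _ _) (≈-trans (⊕-congˡ (∼-involutive y)) x≤y)

  ∼≤⇒∼≤ : ∼ x ≤ y → ∼ y ≤ x
  ∼≤⇒∼≤ ∼x≤y = ≤-trans (∼-anti-≤ ∼x≤y) (≈⇒≤ (∼-involutive _))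

  ≤∼⇒≤∼ : x ≤ ∼ y → y ≤ ∼ x
  ≤∼⇒≤∼ x≤∼y = ≤-trans (≈⇒≤ (≈-sym (∼-involutive _))) (∼-anti-≤ x≤∼y)

  ∼-reflect-≤ : ∼ x ≤ ∼ y → y ≤ x
  ∼-reflect-≤ ∼x≤∼y = ≤-trans (≤∼⇒≤∼ ∼x≤∼y) (≈⇒≤ (∼-involutive _))

  ⇒-monoʳ-≤ : ∀ x → y ≤ z → (x ⇒ y) ≤ (x ⇒ z)
  ⇒-monoʳ-≤ x = ⊕-monoʳ-≤ (∼ x)

  ⇒-antiˡ-≤ : ∀ z → x ≤ y → (y ⇒ z) ≤ (x ⇒ z)
  ⇒-antiˡ-≤ z x≤y = ⊕-monoˡ-≤ z (∼-anti-≤ x≤y)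

  x≤y⇒x : ∀ x y → x ≤ (y ⇒ x)
  x≤y⇒x x y = x≤y⊕x x (∼ y)

  1⇒x≈x : ∀ x → (1# ⇒ x) ≈ x
  1⇒x≈x x = ≈-trans (⊕-congʳ ∼1≈0) (⊕-identityˡ x)

  0⇒x≈1 : ∀ x → (0# ⇒ x) ≈ 1#
  0⇒x≈1 = ⊕-zeroˡ

  x⇒0≈∼x : ∀ x → (x ⇒ 0#) ≈ ∼ x
  x⇒0≈∼x x = ⊕-identityʳ (∼ x)

  ·-comm : ∀ x y → x · y ≈ y · x
  ·-comm x y = ∼-cong (⊕-comm _ _)

  ·-mono-≤ : x ≤ y → z ≤ w → x · z ≤ y · w
  ·-mono-≤ x≤y z≤w = ∼-anti-≤ (⊕-mono-≤ (∼-anti-≤ x≤y) (∼-anti-≤ z≤w))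

  ·-identityˡ : ∀ x → 1# · x ≈ x
  ·-identityˡ x = ≈-trans (∼-cong (1⇒x≈x (∼ x))) (∼-involutive x)

  ·-identityʳ : ∀ x → x · 1# ≈ x
  ·-identityʳ x = ≈-trans (·-comm x 1#) (·-identityˡ x)

  x·y≤x : ∀ x y → x · y ≤ x
  x·y≤x x y = ≤-trans (·-mono-≤ ≤-refl (x≤1 y)) (≈⇒≤ (·-identityʳ x))

  x·y≤y : ∀ x y → x · y ≤ y
  x·y≤y x y = ≤-trans (≈⇒≤ (·-comm x y)) (x·y≤x y x)

  ∼[x·y] : ∀ x y → ∼ (x · y) ≈ (x ⇒ ∼ y)
  ∼[x·y] x y = ∼-involutive _

  curry-⇒ : ∀ x y z → (x · y ⇒ z) ≈ (x ⇒ y ⇒ z)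
  curry-⇒ x y z = ≈-trans (⊕-congʳ (∼[x·y] x y)) (⊕-assoc (∼ x) (∼ y) z)

  residual : x · y ≤ z → x ≤ (y ⇒ z)
  residual xy≤z = ≈-trans (≈-sym (curry-⇒ _ _ _)) xy≤z

  residual⁻¹ : x ≤ (y ⇒ z) → x · y ≤ z
  residual⁻¹ x≤y⇒z = ≈-trans (curry-⇒ _ _ _) x≤y⇒z

  ⇒-swap : ∀ x y z → (x ⇒ y ⇒ z) ≈ (y ⇒ x ⇒ z)
  ⇒-swap x y z = x⊕yz≈y⊕xz (∼ x) (∼ y) z

  ≤⇒-swap : x ≤ (y ⇒ z) → y ≤ (x ⇒ z)
  ≤⇒-swap x≤y⇒z = ≈-trans (⇒-swap _ _ _) x≤y⇒z

  modusPonens : ∀ x y → (x ⇒ y) · x ≤ y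
  modusPonens x y = residual⁻¹ ≤-refl

  x·∼x≈0 : ∀ x → x · ∼ x ≈ 0#
  x·∼x≈0 x = ≤-antisym (residual⁻¹ (≈⇒≤ (≈-sym (≈-trans (x⇒0≈∼x (∼ x)) (∼-involutive x))))) (0≤x _)

  ·-assoc-≤ : ∀ x y z → (x · y) · z ≤ x · (y · z)
  ·-assoc-≤ x y z = residual⁻¹ (residual⁻¹
    (≤-trans (residual ≤-refl) (≈⇒≤ (curry-⇒ y z _))))

  x≤y∨x : ∀ x y → x ≤ y ∨ x
  x≤y∨x x y = x≤y⊕x x _

  x≤x∨y : ∀ x y → x ≤ x ∨ y
  x≤x∨y x y = ≤-trans (x≤y∨x x y) (≈⇒≤ (∨-comm y x))

  -- The defining term of `x ∨ y` is monotone in `x`, hence bounded by `z ∨ y`, which is `z` because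
  -- `y ≤ z`.
  ∨-least : x ≤ z → y ≤ z → x ∨ y ≤ z
  ∨-least {x} {z} {y} x≤z y≤z = begin
    ∼ (∼ x ⊕ y) ⊕ y   ≲⟨ ⊕-monoˡ-≤ y (∼-anti-≤ (⇒-antiˡ-≤ y x≤z)) ⟩
    z ∨ y             ≈⟨ ∨-comm z y ⟩
    y ∨ z             ≈⟨ ≤⇒∨≈ y≤z ⟩
    z                 ∎
    where open ≤-Reasoning

  ∨-mono-≤ : x ≤ y → z ≤ w → x ∨ z ≤ y ∨ w
  ∨-mono-≤ x≤y z≤w = ∨-least (≤-trans x≤y (x≤x∨y _ _)) (≤-trans z≤w (x≤y∨x _ _))

  x∧y≤x : ∀ x y → x ∧ y ≤ x
  x∧y≤x x y = ∼≤⇒∼≤ (x≤x∨y (∼ x) (∼ y))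

  x∧y≤y : ∀ x y → x ∧ y ≤ y
  x∧y≤y x y = ∼≤⇒∼≤ (x≤y∨x (∼ y) (∼ x))

  ∧-greatest : x ≤ y → x ≤ z → x ≤ y ∧ z
  ∧-greatest {x} x≤y x≤z = ∼-reflect-≤ (≤-trans (≈⇒≤ (∼-involutive _))
    (∨-least (∼-anti-≤ x≤y) (∼-anti-≤ x≤z)))

  x·y≤x∧y : ∀ x y → x · y ≤ x ∧ y
  x·y≤x∧y x y = ∧-greatest (x·y≤x x y) (x·y≤y x y)

  ≤⇒∧≈ : x ≤ y → x ∧ y ≈ x
  ≤⇒∧≈ x≤y = ≤-antisym (x∧y≤x _ _) (∧-greatest ≤-refl x≤y)

  ⇒-∧-≤ : ∀ x y z → (x ⇒ y) ∧ (x ⇒ z) ≤ (x ⇒ y ∧ z)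
  ⇒-∧-≤ x y z = residual (∧-greatest (residual⁻¹ (x∧y≤x _ _)) (residual⁻¹ (x∧y≤y _ _)))

  -- Multiplication by `x` is a left adjoint, so it preserves joins.
  ·-distribˡ-∨-≤ : ∀ x y z → x · (y ∨ z) ≤ (x · y) ∨ (x · z)
  ·-distribˡ-∨-≤ x y z = residual⁻¹ (≤⇒-swap (∨-least
    (≤⇒-swap (residual (x≤x∨y _ _))) (≤⇒-swap (residual (x≤y∨x _ _)))))

  -- With m = x ∧ y, x = m ⊕ d₁ and y = m ⊕ d₂, the element e = d₁ ∧ d₂
  -- satisfies m ⊕ e = m and e ≤ ∼ m, so e = 0.

  prelinearity : ∀ x y → (x ⇒ y) ∨ (y ⇒ x) ≈ 1#
  prelinearity x y = 1≤⇒≈1 (begin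
    1#                       ≈⟨ ∼-cong e≈0 ⟨
    ∼ (d₁ ∧ d₂)              ≈⟨ ∼-involutive _ ⟩
    ∼ d₁ ∨ ∼ d₂              ≲⟨ ∨-mono-≤ (≈⇒≤ (∼-involutive _)) (≈⇒≤ (∼-involutive _)) ⟩
    (x ⇒ m) ∨ (y ⇒ m)        ≲⟨ ∨-mono-≤ (⇒-monoʳ-≤ x (x∧y≤y x y)) (⇒-monoʳ-≤ y (x∧y≤x x y)) ⟩
    (x ⇒ y) ∨ (y ⇒ x)        ∎)
    where
    open ≤-Reasoning
    m d₁ d₂ : Carrier
    m  = x ∧ y
    d₁ = ∼ (x ⇒ m)
    d₂ = ∼ (y ⇒ m)

    d⊕m≈ : ∀ {v} → m ≤ v → m ⊕ ∼ (v ⇒ m) ≈ v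
    d⊕m≈ m≤v = ≈-trans (⊕-comm _ _) (≈-trans (∨-comm _ _) (≤⇒∨≈ m≤v))

    m⊕e≤m : m ⊕ (d₁ ∧ d₂) ≤ m
    m⊕e≤m = ∧-greatest
      (≤-trans (⊕-monoʳ-≤ m (x∧y≤x d₁ d₂)) (≈⇒≤ (d⊕m≈ (x∧y≤x x y))))
      (≤-trans (⊕-monoʳ-≤ m (x∧y≤y d₁ d₂)) (≈⇒≤ (d⊕m≈ (x∧y≤y x y))))

    e≤∼m : d₁ ∧ d₂ ≤ ∼ m
    e≤∼m = ≤-trans (x∧y≤x d₁ d₂) (∼-anti-≤ (x≤y⇒x m x))

    -- e = e ∧ ∼ m = (m ⊕ e) · ∼ m
    e≈0 : d₁ ∧ d₂ ≈ 0#
    e≈0 = ≤-antisym (begin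
      d₁ ∧ d₂                               ≲⟨ ≤∼⇒≤∼ lemma ⟩
      (m ⊕ (d₁ ∧ d₂)) · ∼ m                 ≲⟨ ·-mono-≤ m⊕e≤m ≤-refl ⟩
      m · ∼ m                               ≈⟨ x·∼x≈0 m ⟩
      0#                                    ∎) (0≤x _)
      where
      lemma : ∼ (m ⊕ (d₁ ∧ d₂)) ⊕ ∼ ∼ m ≤ ∼ (d₁ ∧ d₂)
      lemma = begin
        ∼ (m ⊕ (d₁ ∧ d₂)) ⊕ ∼ ∼ m                    ≈⟨ ⊕-cong (∼-cong (⊕-congˡ (≈-sym (∼-involutive _)))) (∼-involutive m) ⟩
        ∼ (m ⊕ ∼ ∼ (d₁ ∧ d₂)) ⊕ m                    ≈⟨ ⊕-congʳ (∼-cong (⊕-comm _ _)) ⟩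
        ∼ (d₁ ∧ d₂) ∨ m                              ≲⟨ ∨-least ≤-refl (≤-trans (≈⇒≤ (≈-sym (∼-involutive m))) (∼-anti-≤ e≤∼m)) ⟩
        ∼ (d₁ ∧ d₂)                                  ∎

  -- Consequently the elements whose join with a fixed `z` lies in a given filter are closed under
  -- products. Both the primeness of maximal filters and the separating filter for `G` rest on this.
  ∨-·-≤ : ∀ z x y → (x ∨ z) · (y ∨ z) ≤ (x · y) ∨ z
  ∨-·-≤ z x y = begin
    (x ∨ z) · (y ∨ z)                         ≲⟨ ·-distribˡ-∨-≤ _ y z ⟩
    ((x ∨ z) · y) ∨ ((x ∨ z) · z)             ≲⟨ ∨-mono-≤ (≈⇒≤ (·-comm _ _)) (x·y≤y _ _) ⟩
    (y · (x ∨ z)) ∨ z                         ≲⟨ ∨-mono-≤ (·-distribˡ-∨-≤ y x z) ≤-refl ⟩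
    ((y · x) ∨ (y · z)) ∨ z                   ≲⟨ ∨-least (∨-mono-≤ (≈⇒≤ (·-comm y x)) (x·y≤y y z)) (x≤y∨x _ _) ⟩
    (x · y) ∨ z                               ∎
    where open ≤-Reasoning

  -- Transitivity of implication, with `x ⊕ z` read as `∼ x ⇒ z`. It makes the preorder induced by a
  -- filter compatible with `⊕`.
  ⇒-⊕-monoˡ : ∀ x y z → (x ⇒ y) ≤ (x ⊕ z ⇒ y ⊕ z)
  ⇒-⊕-monoˡ x y z = residual (begin
    (x ⇒ y) · (x ⊕ z)           ≲⟨ ·-mono-≤ ∼y≤ ≤-refl ⟩
    (∼ y ⇒ ∼ x) · (x ⊕ z)       ≲⟨ residual⁻¹ (≤-trans ⇒-trans (⇒-antiˡ-≤ _ x⊕z≤)) ⟩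
    ∼ y ⇒ z                     ≈⟨ ⊕-congʳ (∼-involutive y) ⟩
    y ⊕ z                       ∎)
    where
    open ≤-Reasoning
    ∼y≤ : (x ⇒ y) ≤ (∼ y ⇒ ∼ x)
    ∼y≤ = ≈⇒≤ (≈-trans (⊕-congˡ (≈-sym (∼-involutive y))) (⊕-comm _ _))
    x⊕z≤ : x ⊕ z ≤ (∼ x ⇒ z)
    x⊕z≤ = ≈⇒≤ (⊕-congʳ (≈-sym (∼-involutive x)))
    ⇒-trans : (∼ y ⇒ ∼ x) ≤ ((∼ x ⇒ z) ⇒ (∼ y ⇒ z))
    ⇒-trans = ≤⇒-swap (residual (≤⇒-swap (residual (begin
      ∼ y · ((∼ x ⇒ z) · (∼ y ⇒ ∼ x))   ≈⟨ ·-comm _ _ ⟩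
      ((∼ x ⇒ z) · (∼ y ⇒ ∼ x)) · ∼ y   ≲⟨ ·-assoc-≤ _ _ _ ⟩
      (∼ x ⇒ z) · ((∼ y ⇒ ∼ x) · ∼ y)   ≲⟨ ·-mono-≤ ≤-refl (modusPonens _ _) ⟩
      (∼ x ⇒ z) · ∼ x                   ≲⟨ modusPonens _ _ ⟩
      z                                 ∎))))

-- Dedekind cuts

module ℚ-Lemmas where
  -- The equation says B - A = b - a, so a linear inequality is reduced to a known one by an
  -- identity that the ring solver can check.
  <-by : ∀ {a b A B} → a ℚ.< b → B ℚ.+ a ≡ A ℚ.+ b → A ℚ.< B
  <-by {a} {b} {A} {B} a<b eq = subst₂ ℚ._<_
    (solve 2 (λ A b → A :+ b :- b := A) refl A b)
    (solve 2 (λ B b → B :+ b :- b := B) refl B b)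
    (ℚ.+-monoˡ-< (ℚ.- b) (subst (ℚ._< B ℚ.+ b) eq (ℚ.+-monoʳ-< B a<b)))

  ≤-by : ∀ {a b A B} → a ℚ.≤ b → B ℚ.+ a ≡ A ℚ.+ b → A ℚ.≤ B
  ≤-by {a} {b} {A} {B} a≤b eq = subst₂ ℚ._≤_
    (solve 2 (λ A b → A :+ b :- b := A) refl A b)
    (solve 2 (λ B b → B :+ b :- b := B) refl B b)
    (ℚ.+-monoˡ-≤ (ℚ.- b) (subst (ℚ._≤ B ℚ.+ b) eq (ℚ.+-monoʳ-≤ B a≤b)))

  <-≤-total : ∀ p q → p ℚ.< q ⊎ q ℚ.≤ p
  <-≤-total p q with p ℚ.<? q
  ... | yes p<q = inj₁ p<q
  ... | no  p≮q = inj₂ (ℚ.≮⇒≥ p≮q)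

  ⊓-glb-< : ∀ {q a b} → q ℚ.< a → q ℚ.< b → q ℚ.< a ℚ.⊓ b
  ⊓-glb-< {q} {a} {b} q<a q<b with ℚ.⊓-sel a b
  ... | inj₁ a⊓b≡a = subst (q ℚ.<_) (≡.sym a⊓b≡a) q<a
  ... | inj₂ a⊓b≡b = subst (q ℚ.<_) (≡.sym a⊓b≡b) q<b

  infixr 8 _•_
  _•_ : ℕ → ℚ → ℚ
  _•_ = multiple ℚ.+-0-rawMonoid

  -- Unnormalised rationals bypass the reduction to lowest terms in `ℚ`, so the sum is computed on
  -- numerators.
  toℚᵘ-•1 : ∀ n → toℚᵘ (n • 1ℚ) ℚᵘ.≃ mkℚᵘ (+ n) 0
  toℚᵘ-•1 ℕ.zero    = *≡* refl
  toℚᵘ-•1 (ℕ.suc n) = ℚᵘ.≃-trans (ℚ.toℚᵘ-homo-+ 1ℚ (n • 1ℚ))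
    (ℚᵘ.≃-trans (ℚᵘ.+-congʳ (toℚᵘ 1ℚ) (toℚᵘ-•1 n))
      (*≡* (≡.cong (ℤ._* ℤ.1ℤ) (≡.cong (ℤ._+_ ℤ.1ℤ) (ℤ.*-identityʳ (+ n))))))

  •1-* : ∀ n g → n • 1ℚ ℚ.* g ≡ n • g
  •1-* ℕ.zero    g = ℚ.*-zeroˡ g
  •1-* (ℕ.suc n) g = ≡.trans (ℚ.*-distribʳ-+ g 1ℚ (n • 1ℚ))
    (≡.cong₂ ℚ._+_ (ℚ.*-identityˡ g) (•1-* n g))

  ≤•1 : ∀ q → ∃[ n ] q ℚ.≤ n • 1ℚ
  ≤•1 q@(mkℚ i d _) = ℤ.∣ i ∣ , ℚ.toℚᵘ-cancel-≤
    (ℚᵘ.≤-respʳ-≃ (ℚᵘ.≃-sym (toℚᵘ-•1 ℤ.∣ i ∣))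
      (*≤* (subst (ℤ._≤ + ℤ.∣ i ∣ ℤ.* + ℕ.suc d) (≡.sym (ℤ.*-identityʳ i)) (i≤ i))))
    where
    i≤ : ∀ i → i ℤ.≤ + ℤ.∣ i ∣ ℤ.* + ℕ.suc d
    i≤ (+ n)      = subst (+ n ℤ.≤_) (ℤ.pos-* n (ℕ.suc d)) (ℤ.+≤+ (ℕ.m≤m*n n (ℕ.suc d)))
    i≤ (-[1+ n ]) = ℤ.-≤+

  archimedean : ∀ {g} → 0ℚ ℚ.< g → ∀ q → ∃[ n ] q ℚ.≤ n • g
  archimedean {g} 0<g q = n , subst₂ ℚ._≤_ q/g*g (•1-* n g)
      (ℚ.*-monoʳ-≤-nonNeg g {{ℚ.pos⇒nonNeg g}} q/g≤n)
    where
    instance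
      g-pos : ℚ.Positive g
      g-pos = ℚ.positive 0<g
      g≢0 : ℚ.NonZero g
      g≢0 = ℚ.pos⇒nonZero g
    q/g = q ℚ.* ℚ.1/ g
    n = proj₁ (≤•1 q/g)
    q/g≤n = proj₂ (≤•1 q/g)
    q/g*g : q/g ℚ.* g ≡ q
    q/g*g = ≡.trans (ℚ.*-assoc q (ℚ.1/ g) g)
      (≡.trans (≡.cong (q ℚ.*_) (ℚ.*-inverseˡ g)) (ℚ.*-identityʳ q))

open ℚ-Lemmas

module Classical (em : ∀ {ℓ} → ExcludedMiddle ℓ) where

  by-contradiction : ∀ {p} {P : Set p} → ¬ ¬ P → P
  by-contradiction = decidable-stable em

  module UnitInterval {u : Level} where
    infix 4 _∈ᴵ_ _∉ᴵ_
    _∈ᴵ_ _∉ᴵ_ : ℚ → 𝕀 u → Set u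
    q ∈ᴵ x = q ∈ below (real x)
    q ∉ᴵ x = q ∉ below (real x)

    0ᴵ 1ᴵ : 𝕀 u
    0ᴵ = constᴵ 0𝕀ℚ
    1ᴵ = ∼ᴵ 0ᴵ

    ∈-down : ∀ (x : 𝕀 u) {p q} → p ℚ.< q → q ∈ᴵ x → p ∈ᴵ x
    ∈-down x = ℝ.downward (real x)

    ∈⇒<1 : ∀ (x : 𝕀 u) {q} → q ∈ᴵ x → q ℚ.< 1ℚ
    ∈⇒<1 x q∈ = lower (𝕀.≤1 x q∈)

    <0⇒∈ : ∀ (x : 𝕀 u) {q} → q ℚ.< 0ℚ → q ∈ᴵ x
    <0⇒∈ x q<0 = 𝕀.0≤ x (lift q<0)

    ∈∉⇒< : ∀ (x : 𝕀 u) {p q} → p ∈ᴵ x → q ∉ᴵ x → p ℚ.< q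
    ∈∉⇒< x = ℝ.below⇒<bound (real x)

    -- Walk upwards from -1 in steps of `ε`. The walk starts inside the cut and has to leave it, as
    -- a total length of at least 2 takes it to 1 or beyond.
    located : ∀ (x : 𝕀 u) {ε} → 0ℚ ℚ.< ε → ∃[ b ] b ∈ᴵ x × b ℚ.+ ε ∉ᴵ x
    located x {ε} 0<ε =
      let n , 2≤nε = archimedean 0<ε (1ℚ ℚ.+ 1ℚ) in
      search n (ℚ.- 1ℚ) (<0⇒∈ x (ℚ.negative⁻¹ (ℚ.- 1ℚ)))
        (λ ∈x → ℚ.<-irrefl refl (ℚ.<-≤-trans (∈⇒<1 x ∈x) (≤-by 2≤nε
          (solve 1 (λ m → con (ℚ.- 1ℚ) :+ m :+ con (1ℚ ℚ.+ 1ℚ) := con 1ℚ :+ m) refl (n • ε)))))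
      where
      search : ∀ n a → a ∈ᴵ x → a ℚ.+ n • ε ∉ᴵ x → ∃[ b ] b ∈ᴵ x × b ℚ.+ ε ∉ᴵ x
      search ℕ.zero    a a∈ a∉ = contradiction (subst (_∈ᴵ x) (≡.sym (ℚ.+-identityʳ a)) a∈) a∉
      search (ℕ.suc n) a a∈ a∉ with em {P = a ℚ.+ ε ∈ᴵ x}
      ... | no a+ε∉  = a , a∈ , a+ε∉
      ... | yes a+ε∈ = search n (a ℚ.+ ε) a+ε∈ (a∉ ∘ subst (_∈ᴵ x) (ℚ.+-assoc a ε (n • ε)))

    ≰⇒∃ : ∀ (x y : 𝕀 u) → ¬ x ≤ᴵ y → ∃[ q ] q ∈ᴵ x × q ∉ᴵ y
    ≰⇒∃ x y x≰y = by-contradiction λ ∄ →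
      x≰y λ {q} q∈x → by-contradiction λ q∉y → ∄ (q , q∈x , q∉y)

    ≤ᴵ-total : ∀ (x y : 𝕀 u) → x ≤ᴵ y ⊎ y ≤ᴵ x
    ≤ᴵ-total x y with em {P = x ≤ᴵ y}
    ... | yes x≤y = inj₁ x≤y
    ... | no  x≰y = let q , q∈x , q∉y = ≰⇒∃ x y x≰y in
      inj₂ λ p∈y → ∈-down x (∈∉⇒< y p∈y q∉y) q∈x

    -- `∼ᴵ x` is encoded as a sum of the cuts of 1 and -x. This lemma and `∈∼⁻` replace the two
    -- summands by a single rational; the slack between `q` and `r` is shared out among the strict
    -- inequalities of the sum.
    ∈∼⁺ : ∀ (x : 𝕀 u) {q r} → q ℚ.< r → 1ℚ ℚ.- r ∉ᴵ x → q ∈ᴵ ∼ᴵ x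
    ∈∼⁺ x {q} {r} q<r 1-r∉ =
      let m , q<m , m<r = ℚ.<-dense q<r
          n , m<n , n<r = ℚ.<-dense m<r
      in 1ℚ ℚ.- (n ℚ.- m) , n ℚ.- 1ℚ ,
         lift (<-by m<n (solve 2 (λ m n → con 1ℚ :+ m := con 1ℚ :- (n :- m) :+ n) refl m n)) ,
         (r ℚ.- 1ℚ , ℚ.+-monoˡ-< (ℚ.- 1ℚ) n<r ,
          1-r∉ ∘ subst (_∈ᴵ x) (≡.trans (≡.sym (ℚ.+-identityˡ (ℚ.- (r ℚ.- 1ℚ))))
            (solve 1 (λ r → con 0ℚ :- (r :- con 1ℚ) := con 1ℚ :- r) refl r))) ,
         <-by q<m (solve 3 (λ q m n → con 1ℚ :- (n :- m) :+ (n :- con 1ℚ) :+ q := q :+ m) refl q m n)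

    ∈∼⁻ : ∀ (x : 𝕀 u) {q} → q ∈ᴵ ∼ᴵ x → ∃[ r ] q ℚ.< r × 1ℚ ℚ.- r ∉ᴵ x
    ∈∼⁻ x (a , b , lift a<1 , (r , b<r , -r∉) , q<a+b) =
      1ℚ ℚ.+ r , ℚ.<-trans q<a+b (ℚ.+-mono-< a<1 b<r) ,
      -r∉ ∘ subst (_∈ᴵ x) (≡.trans
        (solve 1 (λ r → con 1ℚ :- (con 1ℚ :+ r) := con 0ℚ :- r) refl r) (ℚ.+-identityˡ (ℚ.- r)))

    ∈1ᴵ : ∀ {q} → q ℚ.< 1ℚ → q ∈ᴵ 1ᴵ
    ∈1ᴵ q<1 = ∈∼⁺ 0ᴵ q<1 λ (lift 0<0) → ℚ.<-irrefl refl 0<0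

    ≤1ᴵ : ∀ (x : 𝕀 u) → x ≤ᴵ 1ᴵ
    ≤1ᴵ x = ∈1ᴵ ∘ ∈⇒<1 x

    ⊕ᴵ-comm-≤ : ∀ (x y : 𝕀 u) → x ⊕ᴵ y ≤ᴵ y ⊕ᴵ x
    ⊕ᴵ-comm-≤ x y {q} ((a , b , a∈x , b∈y , q<a+b) , q<1) =
      (b , a , b∈y , a∈x , subst (q ℚ.<_) (ℚ.+-comm a b) q<a+b) , q<1

    -- Since x ≥ 0, the element of x may be taken slightly negative.
    ∈⊕⁺ : ∀ (x y : 𝕀 u) {q n} → q ℚ.< n → n ∈ᴵ y → q ∈ᴵ x ⊕ᴵ y
    ∈⊕⁺ x y {q} {n} q<n n∈y =
      let m , q<m , m<n = ℚ.<-dense q<n in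
      (m ℚ.- n , n ,
       <0⇒∈ x (<-by m<n (solve 2 (λ m n → con 0ℚ :+ m := m :- n :+ n) refl m n)) , n∈y ,
       <-by q<m (solve 3 (λ q m n → m :- n :+ n :+ q := q :+ m) refl q m n)) ,
      lift (ℚ.<-trans q<n (∈⇒<1 y n∈y))

    ≤⊕ᴵ : ∀ (x y : 𝕀 u) → y ≤ᴵ x ⊕ᴵ y
    ≤⊕ᴵ x y {q} q∈y = let n , q<n , n∈y = ℝ.rounded (real y) q∈y in ∈⊕⁺ x y {q} {n} q<n n∈y

    -- The candidate `e` for the sum of `y` and `z` may exceed the truncation bound 1. In that case
    -- `y ⊕ᴵ z` contains every rational below 1, and one of them above `q` is enough.
    ⊕ᴵ-assoc-≤ : ∀ (x y z : 𝕀 u) → (x ⊕ᴵ y) ⊕ᴵ z ≤ᴵ x ⊕ᴵ (y ⊕ᴵ z)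
    ⊕ᴵ-assoc-≤ x y z {q} ((a , b , ((c , d , c∈x , d∈y , a<c+d) , _) , b∈z , q<a+b) , lift q<1)
      = let e , q-c<e , e<d+b = ℚ.<-dense {q ℚ.- c} {d ℚ.+ b}
              (<-by (ℚ.+-mono-< q<a+b a<c+d)
                (solve 5 (λ q a b c d → d :+ b :+ (q :+ a) := q :- c :+ (a :+ b :+ (c :+ d))) refl q a b c d))
        in split e q-c<e e<d+b (<-≤-total e 1ℚ)
      where
      split : ∀ e → q ℚ.- c ℚ.< e → e ℚ.< d ℚ.+ b → e ℚ.< 1ℚ ⊎ 1ℚ ℚ.≤ e → q ∈ᴵ x ⊕ᴵ (y ⊕ᴵ z)
      split e q-c<e e<d+b (inj₁ e<1) =
        (c , e , c∈x , ((d , b , d∈y , b∈z , e<d+b) , lift e<1) ,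
         <-by q-c<e (solve 3 (λ q c e → c :+ e :+ (q :- c) := q :+ e) refl q c e)) ,
        lift q<1
      split e q-c<e e<d+b (inj₂ 1≤e) =
        let n , q<n , n<1 = ℚ.<-dense q<1 in
        ∈⊕⁺ x (y ⊕ᴵ z) {q} {n} q<n
          ((d , b , d∈y , b∈z , ℚ.<-trans (ℚ.<-≤-trans n<1 1≤e) e<d+b) , lift n<1)

    ⊕ᴵ-assoc : ∀ (x y z : 𝕀 u) → (x ⊕ᴵ y) ⊕ᴵ z ≈ᴵ x ⊕ᴵ (y ⊕ᴵ z)
    ⊕ᴵ-assoc x y z = ⊕ᴵ-assoc-≤ x y z ,
      ⊕ᴵ-comm-≤ z (x ⊕ᴵ y) ∘ ⊕ᴵ-mono {x = z} {z} {y ⊕ᴵ x} {x ⊕ᴵ y} id (⊕ᴵ-comm-≤ y x)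
      ∘ ⊕ᴵ-assoc-≤ z y x
      ∘ ⊕ᴵ-mono {x = y ⊕ᴵ z} {z ⊕ᴵ y} {x} {x} (⊕ᴵ-comm-≤ y z) id ∘ ⊕ᴵ-comm-≤ x (y ⊕ᴵ z)

    ⊕ᴵ-identityˡ : ∀ (x : 𝕀 u) → 0ᴵ ⊕ᴵ x ≈ᴵ x
    ⊕ᴵ-identityˡ x =
      (λ {q} ((a , b , lift a<0 , b∈x , q<a+b) , _) →
        ∈-down x (ℚ.<-trans q<a+b (subst (a ℚ.+ b ℚ.<_) (ℚ.+-identityˡ b) (ℚ.+-monoˡ-< b a<0))) b∈x) ,
      ≤⊕ᴵ 0ᴵ x

    ⊕ᴵ-identityʳ : ∀ (x : 𝕀 u) → x ⊕ᴵ 0ᴵ ≈ᴵ x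
    ⊕ᴵ-identityʳ x = proj₁ (⊕ᴵ-identityˡ x) ∘ ⊕ᴵ-comm-≤ x 0ᴵ , ⊕ᴵ-comm-≤ 0ᴵ x ∘ proj₂ (⊕ᴵ-identityˡ x)

    ∼ᴵ-involutive : ∀ (x : 𝕀 u) → ∼ᴵ ∼ᴵ x ≈ᴵ x
    ∼ᴵ-involutive x = to , from
      where
      1-[1-r] : ∀ r → 1ℚ ℚ.- (1ℚ ℚ.- r) ≡ r
      1-[1-r] = solve 1 (λ r → con 1ℚ :- (con 1ℚ :- r) := r) refl

      1-anti : ∀ {s r} → s ℚ.< r → 1ℚ ℚ.- r ℚ.< 1ℚ ℚ.- s
      1-anti s<r = ℚ.+-monoʳ-< 1ℚ (ℚ.neg-antimono-< s<r)

      to : ∼ᴵ ∼ᴵ x ≤ᴵ x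
      to q∈ = let r , q<r , 1-r∉ = ∈∼⁻ (∼ᴵ x) q∈
                  s , q<s , s<r = ℚ.<-dense q<r
              in ∈-down x q<s (by-contradiction λ s∉x →
                   1-r∉ (∈∼⁺ x (1-anti s<r) (s∉x ∘ subst (_∈ᴵ x) (1-[1-r] s))))

      from : x ≤ᴵ ∼ᴵ ∼ᴵ x
      from {q} q∈ = let r , q<r , r∈x = ℝ.rounded (real x) q∈ in
        ∈∼⁺ (∼ᴵ x) q<r λ 1-r∈ →
          let t , 1-r<t , 1-t∉ = ∈∼⁻ x 1-r∈ in
          1-t∉ (∈-down x (subst (1ℚ ℚ.- t ℚ.<_) (1-[1-r] r) (1-anti 1-r<t)) r∈x)

    ⊕ᴵ-zeroʳ : ∀ (x : 𝕀 u) → x ⊕ᴵ 1ᴵ ≈ᴵ 1ᴵ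
    ⊕ᴵ-zeroʳ x = ≤1ᴵ (x ⊕ᴵ 1ᴵ) , ≤⊕ᴵ x 1ᴵ

    ≤ᴵ⇒∼⊕≈1 : ∀ (x y : 𝕀 u) → x ≤ᴵ y → ∼ᴵ x ⊕ᴵ y ≈ᴵ 1ᴵ
    ≤ᴵ⇒∼⊕≈1 x y x≤y = ≤1ᴵ (∼ᴵ x ⊕ᴵ y) , λ {q} q∈1 →
      let q<1 = ∈⇒<1 1ᴵ q∈1
          m , q<m , m<1 = ℚ.<-dense q<1
          n , m<n , n<1 = ℚ.<-dense m<1
          -- With precision 1 - n, the complement of b + ε is n - b, so m - b lies in `∼ᴵ x` and
          -- adds up with b to m > q.
          b , b∈x , b+ε∉x = located x {1ℚ ℚ.- n}
            (<-by n<1 (solve 1 (λ n → con 1ℚ :- n :+ n := con 0ℚ :+ con 1ℚ) refl n))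
      in (m ℚ.- b , b ,
          ∈∼⁺ x {m ℚ.- b} {n ℚ.- b} (ℚ.+-monoˡ-< (ℚ.- b) m<n)
            (b+ε∉x ∘ subst (_∈ᴵ x) (solve 2 (λ n b → con 1ℚ :- (n :- b) := b :+ (con 1ℚ :- n)) refl n b)) ,
          x≤y b∈x , <-by q<m (solve 3 (λ m b q → m :- b :+ b :+ q := q :+ m) refl m b q)) ,
         lift q<1

    -- For 0 < r the rational 1 - r is below the truncation bound, and `q ∉ᴵ y` would put it into
    -- `∼ᴵ y ⊕ᴵ x`. For r ≤ 0 the summand `a` is negative, and `b`, which lies in `y`, already
    -- exceeds `q`.
    ∨ᴵ-≤ : ∀ (x y : 𝕀 u) → x ≤ᴵ y → ∼ᴵ (∼ᴵ y ⊕ᴵ x) ⊕ᴵ x ≤ᴵ y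
    ∨ᴵ-≤ x y x≤y {q} ((a , b , a∈ , b∈x , q<a+b) , _) =
      let r , a<r , 1-r∉ = ∈∼⁻ (∼ᴵ y ⊕ᴵ x) a∈ in split r a<r 1-r∉ (<-≤-total 0ℚ r)
      where
      split : ∀ r → a ℚ.< r → 1ℚ ℚ.- r ∉ᴵ ∼ᴵ y ⊕ᴵ x → 0ℚ ℚ.< r ⊎ r ℚ.≤ 0ℚ → q ∈ᴵ y
      split r a<r 1-r∉ (inj₂ r≤0) = ∈-down y
        (ℚ.<-trans q<a+b (subst (a ℚ.+ b ℚ.<_) (ℚ.+-identityˡ b)
          (ℚ.+-monoˡ-< b (ℚ.<-≤-trans a<r r≤0))))
        (x≤y b∈x)
      split r a<r 1-r∉ (inj₁ 0<r) = by-contradiction λ q∉y →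
        let q′ , q<q′ , q′<a+b = ℚ.<-dense q<a+b in
        1-r∉ ((1ℚ ℚ.- q′ , b ,
               ∈∼⁺ y {r = 1ℚ ℚ.- q} (ℚ.+-monoʳ-< 1ℚ (ℚ.neg-antimono-< q<q′))
                 (q∉y ∘ subst (_∈ᴵ y) (solve 1 (λ q → con 1ℚ :- (con 1ℚ :- q) := q) refl q)) ,
               b∈x ,
               <-by (ℚ.+-mono-< q′<a+b a<r)
                 (solve 4 (λ q′ a b r → con 1ℚ :- q′ :+ b :+ (q′ :+ a) := con 1ℚ :- r :+ (a :+ b :+ r)) refl q′ a b r)) ,
              lift (<-by 0<r (solve 1 (λ r → con 1ℚ :+ con 0ℚ := con 1ℚ :- r :+ r) refl r)))

    -- With `b` in `x`, `b + ε` outside `x` and `q″` in `y`, the difference of `y` and `x` is at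
    -- least q″ - b - ε. Taking ε = q′ - q for some q < q′ < q″ leaves room for a first summand
    -- above q - b.
    ≤-∨ᴵ : ∀ (x y : 𝕀 u) → y ≤ᴵ ∼ᴵ (∼ᴵ y ⊕ᴵ x) ⊕ᴵ x
    ≤-∨ᴵ x y {q} q∈y =
      let q″ , q<q″ , q″∈y = ℝ.rounded (real y) q∈y
          q′ , q<q′ , q′<q″ = ℚ.<-dense q<q″
      in approximate q″ q′ q″∈y q<q′ q′<q″
      where
      1-r∉ : ∀ q″ ε b → q″ ∈ᴵ y → b ℚ.+ ε ∉ᴵ x → 1ℚ ℚ.- (q″ ℚ.- b ℚ.- ε) ∉ᴵ ∼ᴵ y ⊕ᴵ x
      1-r∉ q″ ε b q″∈y b+ε∉x ((c , d , c∈ , d∈x , 1-r<c+d) , _) =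
        let s , c<s , 1-s∉y = ∈∼⁻ y c∈ in absurd s c<s (∈∉⇒< y q″∈y 1-s∉y)
        where
        absurd : ∀ s → c ℚ.< s → ¬ q″ ℚ.< 1ℚ ℚ.- s
        absurd s c<s q″<1-s = ℚ.<-irrefl {0ℚ} refl (<-by
          (ℚ.+-mono-< (ℚ.+-mono-< 1-r<c+d (∈∉⇒< x d∈x b+ε∉x)) (ℚ.+-mono-< c<s q″<1-s))
          (solve 6 (λ ε q″ b c d s →
              con 0ℚ :+ (con 1ℚ :- (q″ :- b :- ε) :+ d :+ (c :+ q″))
              := con 0ℚ :+ (c :+ d :+ (b :+ ε) :+ (s :+ (con 1ℚ :- s))))
            refl ε q″ b c d s))

      combine : ∀ q″ ε b a → q″ ∈ᴵ y → b ∈ᴵ x → b ℚ.+ ε ∉ᴵ x →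
                q ℚ.- b ℚ.< a → a ℚ.< q″ ℚ.- b ℚ.- ε → q ∈ᴵ ∼ᴵ (∼ᴵ y ⊕ᴵ x) ⊕ᴵ x
      combine q″ ε b a q″∈y b∈x b+ε∉x q-b<a a<r =
        (a , b , ∈∼⁺ (∼ᴵ y ⊕ᴵ x) a<r (1-r∉ q″ ε b q″∈y b+ε∉x) , b∈x ,
         <-by q-b<a (solve 3 (λ q a b → a :+ b :+ (q :- b) := q :+ a) refl q a b)) ,
        lift (∈⇒<1 y q∈y)

      q-b<r : ∀ q″ q′ b → q′ ℚ.< q″ → q ℚ.- b ℚ.< q″ ℚ.- b ℚ.- (q′ ℚ.- q)
      q-b<r q″ q′ b q′<q″ = <-by q′<q″
        (solve 4 (λ q q′ q″ b → q″ :- b :- (q′ :- q) :+ q′ := q :- b :+ q″) refl q q′ q″ b)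

      approximate : ∀ q″ q′ → q″ ∈ᴵ y → q ℚ.< q′ → q′ ℚ.< q″ → q ∈ᴵ ∼ᴵ (∼ᴵ y ⊕ᴵ x) ⊕ᴵ x
      approximate q″ q′ q″∈y q<q′ q′<q″ =
        let b , b∈x , b+ε∉x = located x {q′ ℚ.- q}
              (<-by q<q′ (solve 2 (λ q q′ → q′ :- q :+ q := con 0ℚ :+ q′) refl q q′))
            a , q-b<a , a<r = ℚ.<-dense (q-b<r q″ q′ b q′<q″)
        in combine q″ (q′ ℚ.- q) b a q″∈y b∈x b+ε∉x q-b<a a<r

    ≤⇒∨ᴵ≈ : ∀ (x y : 𝕀 u) → x ≤ᴵ y → ∼ᴵ (∼ᴵ x ⊕ᴵ y) ⊕ᴵ y ≈ᴵ y
    ≤⇒∨ᴵ≈ x y x≤y = proj₁ 0⊕y≈y ∘ proj₁ lhs≈ , proj₂ lhs≈ ∘ proj₂ 0⊕y≈y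
      where
      0⊕y≈y = ⊕ᴵ-identityˡ y
      ∼≈0 : ∼ᴵ (∼ᴵ x ⊕ᴵ y) ≈ᴵ 0ᴵ
      ∼≈0 = let p , r = ∼ᴵ-cong {x = ∼ᴵ x ⊕ᴵ y} {1ᴵ} (≤ᴵ⇒∼⊕≈1 x y x≤y)
                p′ , r′ = ∼ᴵ-involutive 0ᴵ
            in p′ ∘ p , r ∘ r′
      lhs≈ : ∼ᴵ (∼ᴵ x ⊕ᴵ y) ⊕ᴵ y ≈ᴵ 0ᴵ ⊕ᴵ y
      lhs≈ = ⊕ᴵ-cong {x = ∼ᴵ (∼ᴵ x ⊕ᴵ y)} {0ᴵ} {y} {y} ∼≈0 (id , id)

    łukasiewiczᴵ-≤ : ∀ (x y : 𝕀 u) → x ≤ᴵ y → ∼ᴵ (∼ᴵ x ⊕ᴵ y) ⊕ᴵ y ≈ᴵ ∼ᴵ (∼ᴵ y ⊕ᴵ x) ⊕ᴵ x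
    łukasiewiczᴵ-≤ x y x≤y =
      (λ q∈ → ≤-∨ᴵ x y (proj₁ (≤⇒∨ᴵ≈ x y x≤y) q∈)) , (λ q∈ → proj₂ (≤⇒∨ᴵ≈ x y x≤y) (∨ᴵ-≤ x y x≤y q∈))

    łukasiewiczᴵ : ∀ (x y : 𝕀 u) → ∼ᴵ (∼ᴵ x ⊕ᴵ y) ⊕ᴵ y ≈ᴵ ∼ᴵ (∼ᴵ y ⊕ᴵ x) ⊕ᴵ x
    łukasiewiczᴵ x y with ≤ᴵ-total x y
    ... | inj₁ x≤y = łukasiewiczᴵ-≤ x y x≤y
    ... | inj₂ y≤x = let p , r = łukasiewiczᴵ-≤ y x y≤x in r , p

    -- If `y ≤ᴵ x`, the hypothesis makes the difference `∼ᴵ (∼ᴵ x ⊕ᴵ y)` zero, while `x` is at most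
    -- this difference plus `y`.
    ∼⊕≈1⇒≤ᴵ : ∀ (x y : 𝕀 u) → ∼ᴵ x ⊕ᴵ y ≈ᴵ 1ᴵ → x ≤ᴵ y
    ∼⊕≈1⇒≤ᴵ x y ∼x⊕y≈1 with ≤ᴵ-total x y
    ... | inj₁ x≤y = x≤y
    ... | inj₂ y≤x = λ q∈x →
      proj₁ (⊕ᴵ-identityˡ y)
        (⊕ᴵ-mono {x = ∼ᴵ (∼ᴵ x ⊕ᴵ y)} {0ᴵ} {y} {y}
          (proj₁ (∼ᴵ-involutive 0ᴵ) ∘ proj₁ (∼ᴵ-cong {x = ∼ᴵ x ⊕ᴵ y} {1ᴵ} ∼x⊕y≈1)) id
          (≤-∨ᴵ y x q∈x))

    ⊕-constᴵ : ∀ r s t → (value r ℚ.+ value s) ℚ.⊓ 1ℚ ≡ value t → constᴵ r ⊕ᴵ constᴵ s ≈ᴵ constᴵ {u} t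
    ⊕-constᴵ r s t r+s≡t = to , from
      where
      to : constᴵ r ⊕ᴵ constᴵ s ≤ᴵ constᴵ {u} t
      to {q} ((a , b , lift a<r , lift b<s , q<a+b) , lift q<1) =
        lift (subst (q ℚ.<_) r+s≡t (⊓-glb-< (ℚ.<-trans q<a+b (ℚ.+-mono-< a<r b<s)) q<1))

      split : ∀ r s q → q ℚ.< r ℚ.+ s → ∃[ a ] ∃[ b ] a ℚ.< r × b ℚ.< s × q ℚ.< a ℚ.+ b
      split r s q q<r+s =
        let a , q-s<a , a<r = ℚ.<-dense {q ℚ.- s} {r}
              (<-by q<r+s (solve 3 (λ q r s → r :+ q := q :- s :+ (r :+ s)) refl q r s))
        in split′ a q-s<a a<r
        where
        split′ : ∀ a → q ℚ.- s ℚ.< a → a ℚ.< r → ∃[ a ] ∃[ b ] a ℚ.< r × b ℚ.< s × q ℚ.< a ℚ.+ b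
        split′ a q-s<a a<r =
          let b , q-a<b , b<s = ℚ.<-dense {q ℚ.- a} {s}
                (<-by q-s<a (solve 3 (λ q a s → s :+ (q :- s) := q :- a :+ a) refl q a s))
          in a , b , a<r , b<s ,
             <-by q-a<b (solve 3 (λ q a b → a :+ b :+ (q :- a) := q :+ b) refl q a b)

      from : constᴵ {u} t ≤ᴵ constᴵ r ⊕ᴵ constᴵ s
      from {q} (lift q<t) =
        let q<⊓ = subst (q ℚ.<_) (≡.sym r+s≡t) q<t
            a , b , a<r , b<s , q<a+b = split (value r) (value s) q
              (ℚ.<-≤-trans q<⊓ (ℚ.p⊓q≤p (value r ℚ.+ value s) 1ℚ))
        in (a , b , lift a<r , lift b<s , q<a+b) ,
           lift (ℚ.<-≤-trans q<⊓ (ℚ.p⊓q≤q (value r ℚ.+ value s) 1ℚ))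

    ∼-constᴵ : ∀ r s → 1ℚ ℚ.- value r ≡ value s → ∼ᴵ constᴵ r ≈ᴵ constᴵ {u} s
    ∼-constᴵ r s 1-r≡s = to , from
      where
      to : ∼ᴵ constᴵ r ≤ᴵ constᴵ {u} s
      to {q} q∈ = let t , q<t , 1-t∉ = ∈∼⁻ (constᴵ r) q∈ in
        lift (ℚ.<-≤-trans q<t (subst (t ℚ.≤_) 1-r≡s (≤-by (ℚ.≮⇒≥ (1-t∉ ∘ lift))
          (solve 2 (λ r t → con 1ℚ :- r :+ r := t :+ (con 1ℚ :- t)) refl (value r) t))))

      from : constᴵ {u} s ≤ᴵ ∼ᴵ constᴵ r
      from {q} (lift q<s) = ∈∼⁺ (constᴵ r) (subst (q ℚ.<_) (≡.sym 1-r≡s) q<s) λ (lift <r) →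
        ℚ.<-irrefl {0ℚ} refl
          (<-by <r (solve 1 (λ r → con 0ℚ :+ (con 1ℚ :- (con 1ℚ :- r)) := con 0ℚ :+ r) refl (value r)))

    opaque
      isPavelkaAlgebraᴵ : IsPavelkaAlgebra (standard u)
      isPavelkaAlgebraᴵ = record
        { isMVAlgebra = record
          { ⊕-isCommutativeMonoid = record
            { isMonoid = record
              { isSemigroup = record
                { isMagma = record
                  { isEquivalence = Setoid.isEquivalence (𝕀-setoid u)
                  ; ∙-cong = λ {x} {y} {z} {w} → ⊕ᴵ-cong {x = x} {y} {z} {w} }
                ; assoc = ⊕ᴵ-assoc }
              ; identity = ⊕ᴵ-identityˡ , ⊕ᴵ-identityʳ }
            ; comm = λ x y → ⊕ᴵ-comm-≤ x y , ⊕ᴵ-comm-≤ y x }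
          ; ∼-cong       = λ {x} {y} → ∼ᴵ-cong {x = x} {y}
          ; ∼-involutive = ∼ᴵ-involutive
          ; ⊕-zeroʳ      = ⊕ᴵ-zeroʳ
          ; łukasiewicz  = łukasiewiczᴵ
          }
        ; ⊕-const = ⊕-constᴵ
        ; ∼-const = ∼-constᴵ
        }

-- Rational constants

infixl 6 _⊕ℚ_
infixl 7 _·ℚ_
infix  8 ∼ℚ_

_⊕ℚ_ _·ℚ_ : 𝕀ℚ → 𝕀ℚ → 𝕀ℚ
∼ℚ_ : 𝕀ℚ → 𝕀ℚ

r ⊕ℚ s = record
  { value   = (value r ℚ.+ value s) ℚ.⊓ 1ℚ
  ; 0≤value = ℚ.⊓-glb (ℚ.+-mono-≤ (𝕀ℚ.0≤value r) (𝕀ℚ.0≤value s)) (ℚ.nonNegative⁻¹ 1ℚ)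
  ; value≤1 = ℚ.p⊓q≤q (value r ℚ.+ value s) 1ℚ
  }

∼ℚ r = record
  { value   = 1ℚ ℚ.- value r
  ; 0≤value = ≤-by (𝕀ℚ.value≤1 r) (solve 1 (λ r → con 1ℚ :- r :+ r := con 0ℚ :+ con 1ℚ) refl (value r))
  ; value≤1 = ≤-by (𝕀ℚ.0≤value r) (solve 1 (λ r → con 1ℚ :+ con 0ℚ := con 1ℚ :- r :+ r) refl (value r))
  }

r ·ℚ s = ∼ℚ (∼ℚ r ⊕ℚ ∼ℚ s)

1𝕀ℚ : 𝕀ℚ
1𝕀ℚ = record { value = 1ℚ ; 0≤value = ℚ.nonNegative⁻¹ 1ℚ ; value≤1 = ℚ.≤-refl }

module GapLemmas where
  1≰0 : ¬ 1ℚ ℚ.≤ 0ℚ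
  1≰0 1≤0 = ℚ.<-irrefl refl (ℚ.<-≤-trans (ℚ.positive⁻¹ 1ℚ) 1≤0)

  0≤• : ∀ n {g} → 0ℚ ℚ.≤ g → 0ℚ ℚ.≤ n • g
  0≤• ℕ.zero    0≤g = ℚ.≤-refl
  0≤• (ℕ.suc n) 0≤g = ℚ.+-mono-≤ 0≤g (0≤• n 0≤g)

  1≤suc• : ∀ n → 1ℚ ℚ.≤ ℕ.suc n • 1ℚ
  1≤suc• n = ℚ.+-monoʳ-≤ 1ℚ (0≤• n (ℚ.nonNegative⁻¹ 1ℚ))

  •-double : ∀ n {g} → 0ℚ ℚ.≤ g → 1ℚ ℚ.≤ ℕ.suc (ℕ.suc n) • g → 1ℚ ℚ.≤ ℕ.suc n • (g ℚ.+ g)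
  •-double n {g} 0≤g 1≤ = subst (1ℚ ℚ.≤_)
    (≡.sym (≡.cong (g ℚ.+ g ℚ.+_) (×-distrib-+ ℚ.+-0-commutativeMonoid g g n)))
    (≤-by (ℚ.+-mono-≤ 1≤ (0≤• n 0≤g))
      (solve 2 (λ g m → g :+ g :+ (m :+ m) :+ (con 1ℚ :+ con 0ℚ) := con 1ℚ :+ (g :+ (g :+ m) :+ m)) refl g (n • g)))

  p<q⇒0<q-p : ∀ {p q} → p ℚ.< q → 0ℚ ℚ.< q ℚ.- p
  p<q⇒0<q-p {p} {q} p<q = <-by p<q (solve 2 (λ p q → q :- p :+ p := con 0ℚ :+ q) refl p q)

open GapLemmas

-- Pavelka algebras and the uniqueness of their constants

module PavelkaProperties {c ℓ} (A : RawPavelkaAlgebra c ℓ) (isPavelkaAlgebra : IsPavelkaAlgebra A) where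
  open RawPavelkaAlgebra A
  open IsPavelkaAlgebra isPavelkaAlgebra

  mvAlgebra : MVAlgebra c ℓ
  mvAlgebra = record { raw = rawMVAlgebra ; isMVAlgebra = isMVAlgebra }

  open MVProperties mvAlgebra public

  const-⊕ : ∀ r s → const r ⊕ const s ≈ const (r ⊕ℚ s)
  const-⊕ r s = ⊕-const r s (r ⊕ℚ s) refl

  const-∼ : ∀ r → ∼ const r ≈ const (∼ℚ r)
  const-∼ r = ∼-const r (∼ℚ r) refl

  const-· : ∀ r s → const r · const s ≈ const (r ·ℚ s)
  const-· r s = ≈-trans
    (MVAlgebra.∼-cong mvAlgebra (≈-trans (⊕-cong (const-∼ r) (const-∼ s)) (const-⊕ (∼ℚ r) (∼ℚ s))))
    (const-∼ (∼ℚ r ⊕ℚ ∼ℚ s))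

  const-1 : const 1𝕀ℚ ≈ 1#
  const-1 = ≈-sym (∼-const 0𝕀ℚ 1𝕀ℚ refl)

  const-mono-≤ : ∀ r s → value r ℚ.≤ value s → const r ≤ const s
  const-mono-≤ r s r≤s = ≈-trans (⊕-congʳ (const-∼ r)) (≈-trans
    (⊕-const (∼ℚ r) s 1𝕀ℚ (ℚ.p≥q⇒p⊓q≡q {value (∼ℚ r) ℚ.+ value s} {1ℚ} (≤-by r≤s
      (solve 2 (λ r s → con 1ℚ :- r :+ s :+ r := con 1ℚ :+ s) refl (value r) (value s)))))
    const-1)

  -- The order-theoretic properties of [0,1] on which the representation rests. Two constants rather
  -- than one make the separation strict, so that contradictions appear as `s ≤ r` against `r < s`.
  record HasDenseConstants : Set (c ⊔ ℓ) where
    field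
      const-reflect-≤ : ∀ r s → const r ≤ const s → value r ℚ.≤ value s
      dense           : ∀ {x y} → ¬ x ≤ y →
                        ∃[ r ] ∃[ s ] value r ℚ.< value s × const s ≤ x × ¬ const r ≤ y

  -- A monotone MV-homomorphism from the rationals of [0,1]. The case of interest is `const`
  -- followed by an embedding of a quotient.
  record IsConstantFamily (f : 𝕀ℚ → Carrier) : Set ℓ where
    field
      mono   : ∀ r s → value r ℚ.≤ value s → f r ≤ f s
      ⊕-homo : ∀ r s → f (r ⊕ℚ s) ≈ f r ⊕ f s
      ∼-homo : ∀ r → f (∼ℚ r) ≈ ∼ f r
      0-homo : f 0𝕀ℚ ≈ 0#

  module _ (em : ∀ {ℓ} → ExcludedMiddle ℓ) (hasDenseConstants : HasDenseConstants)
           {f} (isConstantFamily : IsConstantFamily f) where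
    open HasDenseConstants hasDenseConstants
    open IsConstantFamily isConstantFamily
    open Classical em

    private
      ·-homo : ∀ r s → f (r ·ℚ s) ≈ f r · f s
      ·-homo r s = ≈-trans (∼-homo _) (MVAlgebra.∼-cong mvAlgebra
        (≈-trans (⊕-homo _ _) (⊕-cong (∼-homo r) (∼-homo s))))

      -- `n` is the induction measure: if `n + 2` copies of the gap reach 1, then so do `n + 1`
      -- copies of its double.
      NoGap : ℕ → Set ℓ
      NoGap n = ∀ t r → 1ℚ ℚ.≤ n • (value t ℚ.- value r) → value r ℚ.< value t → ¬ const t ≤ f r

      -- Doubling (if t ≤ ½) or squaring (if r ≥ ½) doubles the gap t - r.

      double-gap : ∀ n → NoGap (ℕ.suc n) → NoGap (ℕ.suc (ℕ.suc n))
      double-gap n no-gap′ t r 1≤ng r<t ct≤fr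
        = split (ℚ.≤-total (value t ℚ.+ value t) 1ℚ) (ℚ.≤-total 1ℚ (value r ℚ.+ value r))
        where
        low : value t ℚ.+ value t ℚ.≤ 1ℚ → ⊥
        low 2t≤1 = no-gap′ (t ⊕ℚ t) (r ⊕ℚ r)
          (subst (λ g → 1ℚ ℚ.≤ ℕ.suc n • g) g≡ (•-double n (ℚ.<⇒≤ (p<q⇒0<q-p r<t)) 1≤ng))
          (subst₂ ℚ._<_ (≡.sym r⊕r≡) (≡.sym t⊕t≡) 2r<2t)
          (≤-trans (≈⇒≤ (≈-sym (const-⊕ t t))) (≤-trans (⊕-mono-≤ ct≤fr ct≤fr) (≈⇒≤ (≈-sym (⊕-homo r r)))))
          where
          2r<2t = ℚ.+-mono-< r<t r<t
          t⊕t≡ : value (t ⊕ℚ t) ≡ value t ℚ.+ value t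
          t⊕t≡ = ℚ.p≤q⇒p⊓q≡p 2t≤1
          r⊕r≡ : value (r ⊕ℚ r) ≡ value r ℚ.+ value r
          r⊕r≡ = ℚ.p≤q⇒p⊓q≡p (ℚ.≤-trans (ℚ.<⇒≤ 2r<2t) 2t≤1)
          g≡ : value t ℚ.- value r ℚ.+ (value t ℚ.- value r) ≡ value (t ⊕ℚ t) ℚ.- value (r ⊕ℚ r)
          g≡ = ≡.trans (solve 2 (λ t r → t :- r :+ (t :- r) := t :+ t :- (r :+ r)) refl (value t) (value r))
                 (≡.sym (≡.cong₂ ℚ._-_ t⊕t≡ r⊕r≡))

        high : 1ℚ ℚ.≤ value r ℚ.+ value r → ⊥
        high 1≤2r = no-gap′ (t ·ℚ t) (r ·ℚ r)
          (subst (λ g → 1ℚ ℚ.≤ ℕ.suc n • g) g≡ (•-double n (ℚ.<⇒≤ (p<q⇒0<q-p r<t)) 1≤ng))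
          (subst₂ ℚ._<_ (≡.sym r·r≡) (≡.sym t·t≡) (ℚ.+-monoʳ-< 1ℚ (ℚ.neg-antimono-< 2∼t<2∼r)))
          (≤-trans (≈⇒≤ (≈-sym (const-· t t))) (≤-trans (·-mono-≤ ct≤fr ct≤fr) (≈⇒≤ (≈-sym (·-homo r r)))))
          where
          2∼ : 𝕀ℚ → ℚ
          2∼ s = value (∼ℚ s) ℚ.+ value (∼ℚ s)
          ∼t<∼r : value (∼ℚ t) ℚ.< value (∼ℚ r)
          ∼t<∼r = ℚ.+-monoʳ-< 1ℚ (ℚ.neg-antimono-< r<t)
          2∼t<2∼r : 2∼ t ℚ.< 2∼ r
          2∼t<2∼r = ℚ.+-mono-< ∼t<∼r ∼t<∼r
          2∼r≤1 : 2∼ r ℚ.≤ 1ℚ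
          2∼r≤1 = ≤-by 1≤2r (solve 1 (λ r → con 1ℚ :+ con 1ℚ := con 1ℚ :- r :+ (con 1ℚ :- r) :+ (r :+ r)) refl (value r))
          t·t≡ : value (t ·ℚ t) ≡ 1ℚ ℚ.- 2∼ t
          t·t≡ = ≡.cong (λ q → 1ℚ ℚ.- q) (ℚ.p≤q⇒p⊓q≡p (ℚ.≤-trans (ℚ.<⇒≤ 2∼t<2∼r) 2∼r≤1))
          r·r≡ : value (r ·ℚ r) ≡ 1ℚ ℚ.- 2∼ r
          r·r≡ = ≡.cong (λ q → 1ℚ ℚ.- q) (ℚ.p≤q⇒p⊓q≡p 2∼r≤1)
          g≡ : value t ℚ.- value r ℚ.+ (value t ℚ.- value r) ≡ value (t ·ℚ t) ℚ.- value (r ·ℚ r)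
          g≡ = ≡.trans
            (solve 2 (λ t r →
                t :- r :+ (t :- r)
                := con 1ℚ :- (con 1ℚ :- t :+ (con 1ℚ :- t)) :- (con 1ℚ :- (con 1ℚ :- r :+ (con 1ℚ :- r))))
              refl (value t) (value r))
            (≡.sym (≡.cong₂ ℚ._-_ t·t≡ r·r≡))

        split : value t ℚ.+ value t ℚ.≤ 1ℚ ⊎ 1ℚ ℚ.≤ value t ℚ.+ value t →
                1ℚ ℚ.≤ value r ℚ.+ value r ⊎ value r ℚ.+ value r ℚ.≤ 1ℚ → ⊥
        split (inj₁ 2t≤1) _           = low 2t≤1
        split _           (inj₁ 1≤2r) = high 1≤2r
        -- From r ≤ 1/2 follows t ≤ f r ≤ f (1 - r) = ∼ f r ≤ 1 - t, so t ≤ 1/2 after all and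
        -- doubling applies.
        split _           (inj₂ 2r≤1) = low (≤-by
          (const-reflect-≤ t (∼ℚ t) (begin
            const t        ≲⟨ ct≤fr ⟩
            f r            ≲⟨ mono r (∼ℚ r) (≤-by 2r≤1
                               (solve 1 (λ r → con 1ℚ :- r :+ (r :+ r) := r :+ con 1ℚ) refl (value r))) ⟩
            f (∼ℚ r)       ≈⟨ ∼-homo r ⟩
            ∼ f r          ≲⟨ ∼-anti-≤ ct≤fr ⟩
            ∼ const t      ≈⟨ const-∼ t ⟩
            const (∼ℚ t)   ∎))
          (solve 1 (λ t → con 1ℚ :+ t := t :+ t :+ (con 1ℚ :- t)) refl (value t)))
          where open ≤-Reasoning

      no-gap : ∀ n → NoGap n
      no-gap ℕ.zero t r 1≤0 _ _ = 1≰0 1≤0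
      -- A gap of at least 1 leaves only t = 1 and r = 0.
      no-gap (ℕ.suc ℕ.zero) t r 1≤g _ ct≤fr =
        1≰0 (ℚ.≤-trans 1≤t (const-reflect-≤ t 0𝕀ℚ (≤-trans ct≤fr (≤-trans (mono r 0𝕀ℚ r≤0) (≈⇒≤ 0-homo)))))
        where
        1≤t : 1ℚ ℚ.≤ value t
        1≤t = ≤-by (ℚ.+-mono-≤ 1≤g (𝕀ℚ.0≤value r))
          (solve 2 (λ t r → t :+ (con 1ℚ :+ con 0ℚ) := con 1ℚ :+ (t :- r :+ con 0ℚ :+ r)) refl (value t) (value r))
        r≤0 : value r ℚ.≤ 0ℚ
        r≤0 = ≤-by (ℚ.+-mono-≤ 1≤g (𝕀ℚ.value≤1 t))
          (solve 2 (λ t r → con 0ℚ :+ (con 1ℚ :+ t) := r :+ (t :- r :+ con 0ℚ :+ con 1ℚ)) refl (value t) (value r))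
      no-gap (ℕ.suc (ℕ.suc n)) = double-gap n (no-gap (ℕ.suc n))

      f≤const : ∀ r → f r ≤ const r
      f≤const r = by-contradiction λ f≰const →
        let s , t , s<t , ct≤fr , cs≰cr = dense f≰const
            r<t = ℚ.<-trans (ℚ.≰⇒> (cs≰cr ∘ const-mono-≤ s r)) s<t
            n , 1≤ng = archimedean (p<q⇒0<q-p r<t) 1ℚ
        in no-gap n t r 1≤ng r<t ct≤fr

    -- Both `f` and `const` commute with negation, so the upper bound at `∼ℚ r` is a lower bound at
    -- `r`.
    const-unique : ∀ r → f r ≈ const r
    const-unique r = ≤-antisym (f≤const r) (∼-reflect-≤ (begin
      ∼ f r          ≈⟨ ∼-homo r ⟨
      f (∼ℚ r)       ≲⟨ f≤const (∼ℚ r) ⟩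
      const (∼ℚ r)   ≈⟨ const-∼ r ⟨
      ∼ const r      ∎))
      where open ≤-Reasoning

-- Filters and quotients

module FilterProperties {c ℓ} (A : MVAlgebra c ℓ) {p} {F : Pred (MVAlgebra.Carrier A) p}
                        (isFilter : IsFilter (MVAlgebra.raw A) F) where
  open MVAlgebra A
  open MVProperties A
  open IsFilter isFilter

  infix 4 _≲_ _∼F_
  _≲_ _∼F_ : Carrier → Carrier → Set p
  x ≲ y  = (x ⇒ y) ∈ F
  x ∼F y = x ≲ y × y ≲ x

  ∈-resp-≈ : ∀ {x y} → x ≈ y → x ∈ F → y ∈ F
  ∈-resp-≈ x≈y = ↑-closed (≈⇒≤ x≈y)

  ≤⇒≲ : ∀ {x y} → x ≤ y → x ≲ y
  ≤⇒≲ x≤y = ∈-resp-≈ (≈-sym x≤y) 1∈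

  ≲-trans : ∀ {x y z} → x ≲ y → y ≲ z → x ≲ z
  ≲-trans {x} {y} {z} x≲y y≲z = ↑-closed
    (residual (≤-trans (·-assoc-≤ _ _ _) (≤-trans (·-mono-≤ ≤-refl (modusPonens x y)) (modusPonens y z))))
    (·-closed y≲z x≲y)

  ≤-≲-trans : ∀ {x y z} → x ≤ y → y ≲ z → x ≲ z
  ≤-≲-trans x≤y = ≲-trans (≤⇒≲ x≤y)

  ≲-≤-trans : ∀ {x y z} → x ≲ y → y ≤ z → x ≲ z
  ≲-≤-trans x≲y y≤z = ≲-trans x≲y (≤⇒≲ y≤z)

  ⊕-mono-≲ : ∀ {x y z w} → x ≲ y → z ≲ w → x ⊕ z ≲ y ⊕ w
  ⊕-mono-≲ {x} {y} {z} {w} x≲y z≲w = ≲-trans (↑-closed (⇒-⊕-monoˡ x y z) x≲y)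
    (≤-≲-trans (≈⇒≤ (⊕-comm y z)) (≲-≤-trans (↑-closed (⇒-⊕-monoˡ z w y) z≲w) (≈⇒≤ (⊕-comm w y))))

  ∼-anti-≲ : ∀ {x y} → x ≲ y → ∼ y ≲ ∼ x
  ∼-anti-≲ {x} {y} = ∈-resp-≈ (≈-trans (⊕-comm _ _) (⊕-congʳ (≈-sym (∼-involutive y))))

  ·-mono-≲ : ∀ {x y z w} → x ≲ y → z ≲ w → x · z ≲ y · w
  ·-mono-≲ x≲y z≲w = ∼-anti-≲ (⊕-mono-≲ (∼-anti-≲ x≲y) (∼-anti-≲ z≲w))

  ∼F-isCongruence : IsCongruence A _∼F_
  ∼F-isCongruence = record
    { isEquivalence = record
      { refl  = ≤⇒≲ ≤-refl , ≤⇒≲ ≤-refl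
      ; sym   = λ (x≲y , y≲x) → y≲x , x≲y
      ; trans = λ (x≲y , y≲x) (y≲z , z≲y) → ≲-trans x≲y y≲z , ≲-trans z≲y y≲x
      }
    ; reflexive    = λ x≈y → ≤⇒≲ (≈⇒≤ x≈y) , ≤⇒≲ (≈⇒≤ (≈-sym x≈y))
    ; ⊕-compatible = λ (x≲y , y≲x) (z≲w , w≲z) → ⊕-mono-≲ x≲y z≲w , ⊕-mono-≲ y≲x w≲z
    ; ∼-compatible = λ (x≲y , y≲x) → ∼-anti-≲ y≲x , ∼-anti-≲ x≲y
    }

module MaximalFilterProperties (em : ∀ {ℓ} → ExcludedMiddle ℓ) {c ℓ} (A : MVAlgebra c ℓ)
                               (M : MaximalFilter (MVAlgebra.raw A)) where
  open MVAlgebra A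
  open MVProperties A
  open MaximalFilter M renaming (member to F)
  open IsProperFilter isProperFilter
  open FilterProperties A isFilter public

  -- If v ∉ F, then {a ∣ a ∨ v ∈ F} is a proper filter containing F.

  ∨-prime : ∀ {x y} → x ∨ y ∈ F → x ∈ F ⊎ y ∈ F
  ∨-prime {x} {v} x∨v∈ with em {P = v ∈ F}
  ... | yes v∈ = inj₂ v∈
  ... | no  v∉ = inj₁ (maximal F∨v isProper (λ a∈ → ↑-closed (x≤x∨y _ _) a∈) x∨v∈)
    where
    F∨v : Pred Carrier (c ⊔ ℓ)
    F∨v a = a ∨ v ∈ F
    isProper : IsProperFilter raw F∨v
    isProper = record
      { isFilter = record
        { 1∈       = ↑-closed (x≤x∨y _ _) 1∈
        ; ·-closed = λ a∈ b∈ → ↑-closed (∨-·-≤ v _ _) (·-closed a∈ b∈)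
        ; ↑-closed = λ a≤b → ↑-closed (∨-mono-≤ a≤b ≤-refl)
        }
      ; 0∉ = λ 0∨v∈ → v∉ (↑-closed (∨-least (0≤x v) ≤-refl) 0∨v∈)
      }

  ≲-total : ∀ x y → x ≲ y ⊎ y ≲ x
  ≲-total x y = ∨-prime (∈-resp-≈ (≈-sym (prelinearity x y)) 1∈)

-- Density of the rational constants in [0,1]

module StandardProperties (em : ∀ {ℓ} → ExcludedMiddle ℓ) (u : Level) where
  open Classical em
  open UnitInterval {u}
  open PavelkaProperties (standard u) isPavelkaAlgebraᴵ

  const≤⇒∈ : ∀ (x : 𝕀 u) r {q} → constᴵ r ≤ᴵ x → q ℚ.< value r → q ∈ᴵ x
  const≤⇒∈ x r r≤x q<r = r≤x (lift q<r)

  ∈⇒const≤ : ∀ (x : 𝕀 u) r → value r ∈ᴵ x → constᴵ r ≤ᴵ x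
  ∈⇒const≤ x r r∈x (lift q<r) = ∈-down x q<r r∈x

  -- Testing rationals of [0,1] is enough, since negative rationals belong to every element of `𝕀`.
  const-approximates : ∀ (x y : 𝕀 u) → (∀ r → value r ∈ᴵ x → constᴵ r ≤ᴵ y) → x ≤ᴵ y
  const-approximates x y r≤y {q} q∈x =
    let p , q<p , p∈x = ℝ.rounded (real x) q∈x in split p q<p p∈x (<-≤-total p 0ℚ)
    where
    split : ∀ p → q ℚ.< p → p ∈ᴵ x → p ℚ.< 0ℚ ⊎ 0ℚ ℚ.≤ p → q ∈ᴵ y
    split p q<p p∈x (inj₁ p<0) = <0⇒∈ y (ℚ.<-trans q<p p<0)
    split p q<p p∈x (inj₂ 0≤p) =
      r≤y (record { value = p ; 0≤value = 0≤p ; value≤1 = ℚ.<⇒≤ (∈⇒<1 x p∈x) }) p∈x (lift q<p)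

  const-reflectᴵ : ∀ r s → constᴵ {u} r ≤ᴵ constᴵ s → value r ℚ.≤ value s
  const-reflectᴵ r s r≤s = ℚ.≮⇒≥ λ s<r → ℚ.<-irrefl refl (lower (r≤s (lift s<r)))

  denseᴵ : ∀ (x y : 𝕀 u) → ¬ x ≤ᴵ y →
           ∃[ r ] ∃[ s ] value r ℚ.< value s × constᴵ s ≤ᴵ x × ¬ constᴵ r ≤ᴵ y
  denseᴵ x y x≰y = let q , q∈x , q∉y = ≰⇒∃ x y x≰y in separate q q∈x q∉y
    where
    separate : ∀ q → q ∈ᴵ x → q ∉ᴵ y →
               ∃[ r ] ∃[ s ] value r ℚ.< value s × constᴵ s ≤ᴵ x × ¬ constᴵ r ≤ᴵ y
    separate q q∈x q∉y = let s , q<s , s∈x = ℝ.rounded (real x) q∈x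
                             r , q<r , r<s = ℚ.<-dense q<s
                         in constants r s q<r r<s s∈x
      where
      constants : ∀ r s → q ℚ.< r → r ℚ.< s → s ∈ᴵ x →
                  ∃[ r ] ∃[ s ] value r ℚ.< value s × constᴵ s ≤ᴵ x × ¬ constᴵ r ≤ᴵ y
      constants r s q<r r<s s∈x =
        rℚ , sℚ , r<s , (λ {_} → ∈⇒const≤ x sℚ s∈x) , λ r≤y → q∉y (const≤⇒∈ y rℚ r≤y q<r)
        where
        0≤r = ℚ.≤-trans (ℚ.≮⇒≥ (q∉y ∘ <0⇒∈ y)) (ℚ.<⇒≤ q<r)
        s≤1 = ℚ.<⇒≤ (∈⇒<1 x s∈x)
        rℚ sℚ : 𝕀ℚ
        rℚ = record { value = r ; 0≤value = 0≤r ; value≤1 = ℚ.≤-trans (ℚ.<⇒≤ r<s) s≤1 }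
        sℚ = record { value = s ; 0≤value = ℚ.≤-trans 0≤r (ℚ.<⇒≤ r<s) ; value≤1 = s≤1 }

  hasDenseConstants : HasDenseConstants
  hasDenseConstants = record
    { const-reflect-≤ = λ r s r≤s → const-reflectᴵ r s (∼⊕≈1⇒≤ᴵ (constᴵ r) (constᴵ s) r≤s)
    ; dense           = λ {x} {y} x≰y →
        let r , s , r<s , s≤x , r≰y = denseᴵ x y (x≰y ∘ ≤ᴵ⇒∼⊕≈1 x y) in
        r , s , r<s , ≤ᴵ⇒∼⊕≈1 (constᴵ s) x s≤x , r≰y ∘ ∼⊕≈1⇒≤ᴵ (constᴵ r) y
    }

-- Construction of the embedding of A/F into [0,1]

module CanonicalEmbedding (em : ∀ {ℓ} → ExcludedMiddle ℓ) {c ℓ} (A : RawPavelkaAlgebra c ℓ)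
                          (isPavelkaAlgebra : IsPavelkaAlgebra A) where
  open Classical em
  open RawPavelkaAlgebra A
  open IsPavelkaAlgebra isPavelkaAlgebra using (isMVAlgebra)
  open IsMVAlgebra isMVAlgebra using (∼-involutive)
  open PavelkaProperties A isPavelkaAlgebra
  open MaximalFilter using (member)
  private
    v = suc (c ⊔ ℓ)
  open UnitInterval {v}
  open StandardProperties em v
  private
    module 𝕊 = PavelkaProperties (standard v) isPavelkaAlgebraᴵ

  module _ (M : MaximalFilter rawMVAlgebra) where
    open MaximalFilter M using (isProperFilter; maximal) renaming (member to F)
    open IsProperFilter isProperFilter
    open MaximalFilterProperties em mvAlgebra M

    -- Squaring doubles the distance of t from 1.

    private
      Excluded : ℕ → Set (c ⊔ ℓ)
      Excluded n = ∀ t → 1ℚ ℚ.≤ n • (1ℚ ℚ.- value t) → const t ∉ F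

      square-excluded : ∀ n → Excluded (ℕ.suc n) → Excluded (ℕ.suc (ℕ.suc n))
      square-excluded n excluded t 1≤ t∈ = excluded (t ·ℚ t)
        (subst (λ g → 1ℚ ℚ.≤ ℕ.suc n • g) (solve 1 (λ g → g := con 1ℚ :- (con 1ℚ :- g)) refl ((g ℚ.+ g) ℚ.⊓ 1ℚ))
          (gap (ℚ.⊓-sel (g ℚ.+ g) 1ℚ)))
        (∈-resp-≈ (const-· t t) (·-closed t∈ t∈))
        where
        g = 1ℚ ℚ.- value t
        gap : (g ℚ.+ g) ℚ.⊓ 1ℚ ≡ g ℚ.+ g ⊎ (g ℚ.+ g) ℚ.⊓ 1ℚ ≡ 1ℚ → 1ℚ ℚ.≤ ℕ.suc n • ((g ℚ.+ g) ℚ.⊓ 1ℚ)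
        gap (inj₁ ≡2g) = subst (λ g → 1ℚ ℚ.≤ ℕ.suc n • g) (≡.sym ≡2g) (•-double n (𝕀ℚ.0≤value (∼ℚ t)) 1≤)
        gap (inj₂ ≡1)  = subst (λ g → 1ℚ ℚ.≤ ℕ.suc n • g) (≡.sym ≡1) (1≤suc• n)

      excluded : ∀ n → Excluded n
      excluded ℕ.zero            t 1≤0 _  = 1≰0 1≤0
      excluded (ℕ.suc ℕ.zero)    t 1≤g t∈ = 0∉ (↑-closed (const-mono-≤ t 0𝕀ℚ (≤-by 1≤g
        (solve 1 (λ t → con 0ℚ :+ con 1ℚ := t :+ (con 1ℚ :- t :+ con 0ℚ)) refl (value t)))) t∈)
      excluded (ℕ.suc (ℕ.suc n)) = square-excluded n (excluded (ℕ.suc n))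

    const<1⇒∉ : ∀ t → value t ℚ.< 1ℚ → const t ∉ F
    const<1⇒∉ t t<1 = let n , 1≤ = archimedean (p<q⇒0<q-p t<1) 1ℚ in excluded n t 1≤

    -- If s < r, then `const r ⇒ const s` is a constant below 1, and a proper filter contains none
    -- of these.
    const-reflect-≲ : ∀ r s → const r ≲ const s → value r ℚ.≤ value s
    const-reflect-≲ r s r≲s = ℚ.≮⇒≥ λ s<r → const<1⇒∉ (∼ℚ r ⊕ℚ s)
      (ℚ.≤-<-trans (ℚ.p⊓q≤p (value (∼ℚ r) ℚ.+ value s) 1ℚ)
        (<-by s<r (solve 2 (λ r s → con 1ℚ :+ s := con 1ℚ :- r :+ s :+ r) refl (value r) (value s))))
      (∈-resp-≈ (≈-trans (⊕-congʳ (const-∼ r)) (const-⊕ (∼ℚ r) s)) r≲s)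

    h : Carrier → 𝕀 v
    h x = record
      { real = record
        { below     = λ q → Lift v (∃[ r ] q ℚ.< value r × const r ≲ x)
        ; inhabited = ℚ.- 1ℚ , lift (0𝕀ℚ , ℚ.negative⁻¹ (ℚ.- 1ℚ) , ≤⇒≲ (0≤x x))
        ; bounded   = 1ℚ , λ (lift (r , 1<r , _)) → ℚ.<-irrefl refl (ℚ.<-≤-trans 1<r (𝕀ℚ.value≤1 r))
        ; downward  = λ p<q (lift (r , q<r , r≲x)) → lift (r , ℚ.<-trans p<q q<r , r≲x)
        ; rounded   = λ (lift (r , q<r , r≲x)) →
                      let m , q<m , m<r = ℚ.<-dense q<r in m , q<m , lift (r , m<r , r≲x)
        }
      ; 0≤ = λ (lift q<0) → lift (0𝕀ℚ , q<0 , ≤⇒≲ (0≤x x))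
      ; ≤1 = λ (lift (r , q<r , _)) → lift (ℚ.<-≤-trans q<r (𝕀ℚ.value≤1 r))
      }

    ∈h⁻ : ∀ x r → value r ∈ᴵ h x → const r ≲ x
    ∈h⁻ x r (lift (s , r<s , s≲x)) = ≤-≲-trans (const-mono-≤ r s (ℚ.<⇒≤ r<s)) s≲x

    const≤h : ∀ x r → const r ≲ x → constᴵ r ≤ᴵ h x
    const≤h x r r≲x (lift q<r) = lift (r , q<r , r≲x)

    h-mono : ∀ {x y} → x ≲ y → h x ≤ᴵ h y
    h-mono x≲y (lift (r , q<r , r≲x)) = lift (r , q<r , ≲-trans r≲x x≲y)

    h-0 : h 0# ≈ᴵ 0ᴵ
    h-0 = (λ (lift (r , q<r , r≲0)) → lift (ℚ.<-≤-trans q<r (const-reflect-≲ r 0𝕀ℚ r≲0))) ,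
          const≤h 0# 0𝕀ℚ (≤⇒≲ ≤-refl)

    h-∼-≤ : ∀ x → h (∼ x) ≤ᴵ ∼ᴵ h x
    h-∼-≤ x {q} (lift (r , q<r , r≲∼x)) = ∈∼⁺ (h x) q<r λ (lift (s , 1-r<s , s≲x)) →
      ℚ.<-irrefl refl (ℚ.<-≤-trans 1-r<s (const-reflect-≲ s (∼ℚ r) (≲-trans s≲x
        (≤-≲-trans (≈⇒≤ (≈-sym (∼-involutive x))) (≲-≤-trans (∼-anti-≲ r≲∼x) (≈⇒≤ (const-∼ r)))))))

    -- A/F is a chain: when 1 - r is not below `x` modulo `F`, then `x` is below 1 - r, and so r is
    -- below `∼ x`.
    ∼-h-≤ : ∀ x → ∼ᴵ h x ≤ᴵ h (∼ x)
    ∼-h-≤ x = const-approximates (∼ᴵ h x) (h (∼ x)) λ r r∈ →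
      let s , r<s , 1-s∉ = ∈∼⁻ (h x) r∈ in
      const≤h (∼ x) r (≤-≲-trans (≈⇒≤ (≈-trans (≈-sym (∼-involutive _)) (IsMVAlgebra.∼-cong isMVAlgebra (const-∼ r))))
        (∼-anti-≲ (x≲∼r r (λ ∼r≲x → 1-s∉ (lift (∼ℚ r , ℚ.+-monoʳ-< 1ℚ (ℚ.neg-antimono-< r<s) , ∼r≲x))))))
      where
      x≲∼r : ∀ r → ¬ const (∼ℚ r) ≲ x → x ≲ const (∼ℚ r)
      x≲∼r r ∼r≴x = fromInj₁ (λ ∼r≲x → contradiction ∼r≲x ∼r≴x) (≲-total x (const (∼ℚ r)))

    -- The residuated form of h x · h y ≤ h z. Residuation isolates each factor in turn, so that
    -- both can be tested on constants r ≲ x and s ≲ y, whose product is below `z` modulo `F`.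
    h-·-≤ : ∀ x y z → x · y ≲ z → h x ≤ᴵ ∼ᴵ h y ⊕ᴵ h z
    h-·-≤ x y z xy≲z = const-approximates (h x) (∼ᴵ h y ⊕ᴵ h z) λ r r∈ →
      ∼⊕≈1⇒≤ᴵ (constᴵ r) (∼ᴵ h y ⊕ᴵ h z)
      (𝕊.≤⇒-swap {h y} {constᴵ r} {h z} (≤ᴵ⇒∼⊕≈1 (h y) (∼ᴵ constᴵ r ⊕ᴵ h z)
        (const-approximates (h y) (∼ᴵ constᴵ r ⊕ᴵ h z) λ s s∈ →
          ∼⊕≈1⇒≤ᴵ (constᴵ s) (∼ᴵ constᴵ r ⊕ᴵ h z)
          (𝕊.residual {constᴵ s} {constᴵ r} {h z}
            (𝕊.≤-trans {∼ᴵ (∼ᴵ constᴵ s ⊕ᴵ ∼ᴵ constᴵ r)} {constᴵ (s ·ℚ r)} {h z}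
              (𝕊.≈⇒≤ {∼ᴵ (∼ᴵ constᴵ s ⊕ᴵ ∼ᴵ constᴵ r)} {constᴵ (s ·ℚ r)} (𝕊.const-· s r))
              (≤ᴵ⇒∼⊕≈1 (constᴵ (s ·ℚ r)) (h z) (const≤h z (s ·ℚ r)
                (≤-≲-trans (≈⇒≤ (≈-trans (≈-sym (const-· s r)) (·-comm _ _)))
                  (≲-trans (·-mono-≲ (∈h⁻ x r r∈) (∈h⁻ y s s∈)) xy≲z)))))))))

    -- The residuated form applies because `(x ⊕ y) · ∼ x ≤ y`.
    h-⊕-≤ : ∀ x y → h (x ⊕ y) ≤ᴵ h x ⊕ᴵ h y
    h-⊕-≤ x y =
      ⊕ᴵ-mono {x = ∼ᴵ h (∼ x)} {h x} {h y} {h y}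
        (proj₁ (∼ᴵ-involutive (h x)) ∘ ∼ᴵ-anti {x = ∼ᴵ h x} {h (∼ x)} (∼-h-≤ x)) id
      ∘ h-·-≤ (x ⊕ y) (∼ x) y (≤⇒≲ (residual⁻¹ (≈⇒≤ (⊕-congʳ (≈-sym (∼-involutive x))))))

    ⊕-h-≤ : ∀ x y → h x ⊕ᴵ h y ≤ᴵ h (x ⊕ y)
    ⊕-h-≤ x y ((a , b , lift (r , a<r , r≲x) , lift (s , b<s , s≲y) , q<a+b) , lift q<1) =
      lift (r ⊕ℚ s , ⊓-glb-< (ℚ.<-trans q<a+b (ℚ.+-mono-< a<r b<s)) q<1 ,
            ≤-≲-trans (≈⇒≤ (≈-sym (const-⊕ r s))) (⊕-mono-≲ r≲x s≲y))

    -- The a with r ≲ a for all r < 1 form a proper filter, which equals F as F is maximal.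

    ∈F : ∀ {x} → (∀ r → value r ℚ.< 1ℚ → const r ≲ x) → x ∈ F
    ∈F r≲x = maximal F₁ isProper (λ a∈ r _ → ↑-closed (x≤y⇒x _ _) a∈) r≲x
      where
      F₁ : Pred Carrier (c ⊔ ℓ)
      F₁ a = ∀ r → value r ℚ.< 1ℚ → const r ≲ a

      -- r ≤ s · s′ for r < s < 1 and s′ = 1 - (s - r)
      closed : ∀ {a b} → a ∈ F₁ → b ∈ F₁ → a · b ∈ F₁
      closed {a} {b} a∈ b∈ r r<1 = let q , r<q , q<1 = ℚ.<-dense r<1 in split q r<q q<1
        where
        split : ∀ q → value r ℚ.< q → q ℚ.< 1ℚ → const r ≲ a · b
        split q r<q q<1 = ≤-≲-trans
          (≤-trans (const-mono-≤ r (s ·ℚ s′) r≤s·s′) (≈⇒≤ (≈-sym (const-· s s′))))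
          (·-mono-≲ (a∈ s q<1) (b∈ s′ (<-by r<q
            (solve 2 (λ q r → con 1ℚ :+ r := con 1ℚ :- (q :- r) :+ q) refl q (value r)))))
          where
          s s′ : 𝕀ℚ
          s  = record { value = q ; 0≤value = ℚ.≤-trans (𝕀ℚ.0≤value r) (ℚ.<⇒≤ r<q) ; value≤1 = ℚ.<⇒≤ q<1 }
          s′ = record
            { value   = 1ℚ ℚ.- (q ℚ.- value r)
            ; 0≤value = ≤-by (ℚ.+-mono-≤ (𝕀ℚ.0≤value r) (ℚ.<⇒≤ q<1))
                (solve 2 (λ q r → con 1ℚ :- (q :- r) :+ (con 0ℚ :+ q) := con 0ℚ :+ (r :+ con 1ℚ)) refl q (value r))
            ; value≤1 = ≤-by (ℚ.<⇒≤ r<q)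
                (solve 2 (λ q r → con 1ℚ :+ r := con 1ℚ :- (q :- r) :+ q) refl q (value r))
            }
          r≤s·s′ : value r ℚ.≤ value (s ·ℚ s′)
          r≤s·s′ = ≤-by (ℚ.p⊓q≤p (value (∼ℚ s) ℚ.+ value (∼ℚ s′)) 1ℚ)
            (solve 3 (λ q r m →
                con 1ℚ :- m :+ m
                := r :+ (con 1ℚ :- q :+ (con 1ℚ :- (con 1ℚ :- (q :- r)))))
              refl q (value r) (value (∼ℚ s ⊕ℚ ∼ℚ s′)))

      isProper : IsProperFilter rawMVAlgebra F₁
      isProper = record
        { isFilter = record
          { 1∈       = λ r _ → ≤⇒≲ (x≤1 _)
          ; ·-closed = closed
          ; ↑-closed = λ x≤y x∈ r r<1 → ≲-≤-trans (x∈ r r<1) x≤y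
          }
        ; 0∉ = λ 0∈ → let q , 0<q , q<1 = ℚ.<-dense (ℚ.positive⁻¹ 1ℚ) in
            ℚ.<-irrefl refl (ℚ.<-≤-trans 0<q (const-reflect-≲
              (record { value = q ; 0≤value = ℚ.<⇒≤ 0<q ; value≤1 = ℚ.<⇒≤ q<1 }) 0𝕀ℚ (0∈ _ q<1)))
        }

    -- The hypothesis gives h (x ⇒ y) = 1, which only says that every constant below 1 is below
    -- `x ⇒ y` modulo `F`. Maximality, through `∈F`, turns this into membership.
    h-reflect : ∀ x y → h x ≤ᴵ h y → x ≲ y
    h-reflect x y hx≤hy = ∈F λ r r<1 → ∈h⁻ (x ⇒ y) r (1≤h[x⇒y] (∈1ᴵ r<1))
      where
      1≤h[x⇒y] : 1ᴵ ≤ᴵ h (x ⇒ y)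
      1≤h[x⇒y] = ⊕-h-≤ (∼ x) y
        ∘ ⊕ᴵ-mono {x = ∼ᴵ h x} {h (∼ x)} {h y} {h y} (∼-h-≤ x) id
        ∘ proj₂ (≤ᴵ⇒∼⊕≈1 (h x) (h y) hx≤hy)

  h-monoʳ : ∀ x (M M′ : MaximalFilter rawMVAlgebra) → member M ⊆ member M′ → h M x ≤ᴵ h M′ x
  h-monoʳ x M M′ M⊆M′ (lift (r , q<r , r≲x)) = lift (r , q<r , M⊆M′ r≲x)

  quotientEmbeddings : QuotientEmbeddings rawMVAlgebra
  quotientEmbeddings = record
    { _/_         = λ x M → h M x
    ; /-congʳ     = λ x {M} {M′} (M⊆M′ , M′⊆M) →
        (λ {_} → h-monoʳ x M M′ M⊆M′) , (λ {_} → h-monoʳ x M′ M M′⊆M)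
    ; isEmbedding = λ M → record
      { isMVHomomorphism = record
        { cong   = λ (x≲y , y≲x) → h-mono M x≲y , h-mono M y≲x
        ; ⊕-homo = λ x y → h-⊕-≤ M x y , ⊕-h-≤ M x y
        ; ∼-homo = λ x → h-∼-≤ M x , ∼-h-≤ M x
        ; 0-homo = h-0 M
        }
      ; injective = λ {x} {y} (hx≤hy , hy≤hx) → h-reflect M x y hx≤hy , h-reflect M y x hy≤hx
      }
    }

-- Existence of maximal filters

module Resizing (em : ∀ {ℓ} → ExcludedMiddle ℓ) where
  -- Classically a proposition is equivalent to the truth of a Boolean, which fits into any
  -- universe. This brings unions of chains and kernels to the level at which maximal filters are
  -- defined.
  Resized : ∀ {a} b → Set a → Set b
  Resized b P = Lift b (True (em {P = P}))

  resize : ∀ {a b} {P : Set a} → P → Resized b P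
  resize p = lift (fromWitness p)

  unresize : ∀ {a b} {P : Set a} → Resized b P → P
  unresize (lift p) = toWitness p

module _ (em : ∀ {ℓ} → ExcludedMiddle ℓ) (zorn : ∀ {c ℓ₁ ℓ₂ p} → Zorn c ℓ₁ ℓ₂ p)
         {c ℓ} (A : RawMVAlgebra c ℓ) where
  open RawMVAlgebra A
  open MaximalFilter using (member)
  open Resizing em

  maximalExtension : ∀ (F₀ : Pred Carrier (c ⊔ ℓ)) → IsProperFilter A F₀ → ∃[ M ] F₀ ⊆ member {A = A} M
  maximalExtension F₀ F₀-proper = let (M , M-proper , F₀⊆M) , max = zorn {p = 0ℓ} extensions bound in
    record
      { member         = M
      ; isProperFilter = M-proper
      ; maximal        = λ F F-proper M⊆F → max {F , F-proper , λ {_} a∈ → M⊆F (F₀⊆M a∈)} M⊆F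
      } , F₀⊆M
    where
    Extension : Set (suc (c ⊔ ℓ))
    Extension = ∃[ F ] IsProperFilter A {c ⊔ ℓ} F × F₀ ⊆ F

    extensions : Poset (suc (c ⊔ ℓ)) (c ⊔ ℓ) (c ⊔ ℓ)
    extensions = record
      { Carrier        = Extension
      ; _≈_            = λ E E′ → proj₁ E ≐ proj₁ E′
      ; _≤_            = λ E E′ → proj₁ E ⊆ proj₁ E′
      ; isPartialOrder = record
        { isPreorder = record
          { isEquivalence = record
            { refl  = id , id
            ; sym   = λ (p , q) → q , p
            ; trans = λ (p , q) (p′ , q′) → p′ ∘ p , q ∘ q′
            }
          ; reflexive = proj₁
          ; trans     = λ p q → q ∘ p
          }
        ; antisym = _,_
        }
      }

    bound : (C : Pred Extension 0ℓ) →
            (∀ {E E′} → E ∈ C → E′ ∈ C → proj₁ E ⊆ proj₁ E′ ⊎ proj₁ E′ ⊆ proj₁ E) →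
            ∃[ U ] (∀ {E} → E ∈ C → proj₁ E ⊆ proj₁ U)
    bound C chain =
      ((λ a → Resized (c ⊔ ℓ) (a ∈ U)) , U-proper , λ {_} a∈ → resize (inj₁ a∈)) ,
      λ {E} E∈C {_} a∈ → resize (inj₂ (E , E∈C , a∈))
      where
      -- `F₀` is included so that the empty chain has an upper bound as well.
      U : Pred Carrier (suc (c ⊔ ℓ))
      U a = a ∈ F₀ ⊎ ∃[ E ] E ∈ C × a ∈ proj₁ E

      -- Any two elements of the union lie in one proper filter inside it, from which the union
      -- inherits closure and properness.
      within : ∀ {a b} → a ∈ U → b ∈ U →
               ∃[ F ] IsProperFilter A {c ⊔ ℓ} F × F ⊆ U × a ∈ F × b ∈ F
      within (inj₁ a∈) (inj₁ b∈) = F₀ , F₀-proper , inj₁ , a∈ , b∈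
      within (inj₁ a∈) (inj₂ (E@(F , F-proper , F₀⊆F) , E∈C , b∈)) =
        F , F-proper , (λ {_} x∈ → inj₂ (E , E∈C , x∈)) , F₀⊆F a∈ , b∈
      within (inj₂ (E@(F , F-proper , F₀⊆F) , E∈C , a∈)) (inj₁ b∈) =
        F , F-proper , (λ {_} x∈ → inj₂ (E , E∈C , x∈)) , a∈ , F₀⊆F b∈
      within (inj₂ (E@(F , F-proper , _) , E∈C , a∈)) (inj₂ (E′@(F′ , F′-proper , _) , E′∈C , b∈)) =
        [ (λ (F⊆F′ : F ⊆ F′) → F′ , F′-proper , (λ {_} x∈ → inj₂ (E′ , E′∈C , x∈)) , F⊆F′ a∈ , b∈)
        , (λ (F′⊆F : F′ ⊆ F) → F , F-proper , (λ {_} x∈ → inj₂ (E , E∈C , x∈)) , a∈ , F′⊆F b∈)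
        ]′ (chain E∈C E′∈C)

      U-proper : IsProperFilter A (λ a → Resized (c ⊔ ℓ) (a ∈ U))
      U-proper = record
        { isFilter = record
          { 1∈       = resize (inj₁ (IsProperFilter.1∈ F₀-proper))
          ; ·-closed = λ a∈ b∈ →
              let _ , F-proper , F⊆U , a∈F , b∈F = within (unresize a∈) (unresize b∈) in
              resize (F⊆U (IsProperFilter.·-closed F-proper a∈F b∈F))
          ; ↑-closed = λ a≤b a∈ →
              let _ , F-proper , F⊆U , a∈F , _ = within (unresize a∈) (unresize a∈) in
              resize (F⊆U (IsProperFilter.↑-closed F-proper a≤b a∈F))
          }
        ; 0∉ = λ 0∈ →
            let _ , F-proper , _ , 0∈F , _ = within (unresize 0∈) (unresize 0∈) in
            IsProperFilter.0∉ F-proper 0∈F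
        }

-- Homomorphisms onto simple algebras and maximality of their kernels

module _ {a ℓ b m} (A : MVAlgebra a ℓ) (B : MVAlgebra b m) {f}
         (isHom : IsMVHomomorphism (MVAlgebra.raw A) (MVAlgebra.raw B) f) where
  private
    module A = MVAlgebra A
    module B where
      open MVAlgebra B public
      open MVProperties B public
  open IsMVHomomorphism isHom

  1-homo : f A.1# B.≈ B.1#
  1-homo = B.≈-trans (∼-homo A.0#) (B.∼-cong 0-homo)

  ⇒-homo : ∀ x y → f (x A.⇒ y) B.≈ (f x B.⇒ f y)
  ⇒-homo x y = B.≈-trans (⊕-homo _ _) (B.⊕-congʳ (∼-homo x))

  ·-homo : ∀ x y → f (x A.· y) B.≈ f x B.· f y
  ·-homo x y = B.≈-trans (∼-homo _) (B.∼-cong (B.≈-trans (⊕-homo _ _) (B.⊕-cong (∼-homo x) (∼-homo y))))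

  ∨-homo : ∀ x y → f (x A.∨ y) B.≈ f x B.∨ f y
  ∨-homo x y = B.≈-trans (⊕-homo _ _) (B.⊕-congʳ (B.≈-trans (∼-homo _) (B.∼-cong (⇒-homo x y))))

module SimpleQuotient (em : ∀ {ℓ} → ExcludedMiddle ℓ) {a ℓ b m} (A : MVAlgebra a ℓ) (B : MVAlgebra b m)
         {f} (isHom : IsMVHomomorphism (MVAlgebra.raw A) (MVAlgebra.raw B) f)
         (surjective : ∀ y → ∃[ x ] MVAlgebra._≈_ B (f x) y) (B-simple : IsSimple B) where
  private
    module A where
      open MVAlgebra A public
      open MVProperties A public
    module B where
      open MVAlgebra B public
      open MVProperties B public
  open IsMVHomomorphism isHom
  open IsSimple B-simple
  open Resizing em

  kernel : Pred A.Carrier (a ⊔ ℓ)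
  kernel x = Resized (a ⊔ ℓ) (f x B.≈ B.1#)

  ∈kernel⇒f≤ : ∀ {x y} → (x A.⇒ y) ∈ kernel → f x B.≤ f y
  ∈kernel⇒f≤ ∈k = B.≈-trans (B.≈-sym (⇒-homo A B isHom _ _)) (unresize ∈k)

  kernel-proper : IsProperFilter A.raw kernel
  kernel-proper = record
    { isFilter = record
      { 1∈       = resize (1-homo A B isHom)
      ; ·-closed = λ x∈ y∈ → resize (B.≈-trans (·-homo A B isHom _ _)
          (B.≈-trans (B.∼-cong (B.⊕-cong (B.∼-cong (unresize x∈)) (B.∼-cong (unresize y∈)))) (B.·-identityˡ B.1#)))
      ; ↑-closed = λ x≤y x∈ → resize (B.1≤⇒≈1 (B.≤-trans (B.≈⇒≤ (B.≈-sym (unresize x∈)))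
          (B.≈-trans (B.≈-sym (⇒-homo A B isHom _ _)) (B.≈-trans (cong x≤y) (1-homo A B isHom)))))
      }
    ; 0∉ = λ 0∈ → nontrivial (B.≈-trans (B.≈-sym 0-homo) (unresize 0∈))
    }

  -- The image of a filter F ⊇ kernel is a filter of B; by simplicity the
  -- congruence it induces is either the equality or the total relation.

  module _ (F : Pred A.Carrier (a ⊔ ℓ)) (F-proper : IsProperFilter A.raw F) (kernel⊆F : kernel ⊆ F) where
    open IsProperFilter F-proper

    image : Pred B.Carrier (a ⊔ ℓ ⊔ m)
    image y = ∃[ x ] x ∈ F × f x B.≈ y

    image-isFilter : IsFilter B.raw image
    image-isFilter = record
      { 1∈       = A.1# , 1∈ , 1-homo A B isHom
      ; ·-closed = λ (x , x∈ , fx≈) (y , y∈ , fy≈) →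
          x A.· y , ·-closed x∈ y∈ ,
          B.≈-trans (·-homo A B isHom x y) (B.∼-cong (B.⊕-cong (B.∼-cong fx≈) (B.∼-cong fy≈)))
      ; ↑-closed = λ {u} {v} u≤v (x , x∈ , fx≈u) →
          -- The preimage `y` may lie outside `F`, but `x ∨ y` is in `F` and also maps to `v`, since
          -- f x ≤ f y.
          let y , fy≈v = surjective v in
          x A.∨ y , ↑-closed (A.x≤x∨y x y) x∈ ,
          B.≈-trans (∨-homo A B isHom x y) (B.≈-trans
            (B.≤⇒∨≈ (B.≤-trans (B.≈⇒≤ fx≈u) (B.≤-trans u≤v (B.≈⇒≤ (B.≈-sym fy≈v))))) fy≈v)
      }

    private
      module I = FilterProperties B image-isFilter
      module C = IsCongruence I.∼F-isCongruence
      module E = IsEquivalence C.isEquivalence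

    resized-isCongruence : IsCongruence B (λ u v → Resized (b ⊔ m) (u I.∼F v))
    resized-isCongruence = record
      { isEquivalence = record
        { refl  = resize E.refl
        ; sym   = λ p → resize (E.sym (unresize p))
        ; trans = λ p q → resize (E.trans (unresize p) (unresize q))
        }
      ; reflexive    = λ p → resize (C.reflexive p)
      ; ⊕-compatible = λ p q → resize (C.⊕-compatible (unresize p) (unresize q))
      ; ∼-compatible = λ p → resize (C.∼-compatible (unresize p))
      }

    -- If the congruence is equality, then `f x`, being related to 1, equals 1. If it is total, some
    -- `y` in `F` maps to 0; then `∼ y` is in the kernel, hence in `F`, and so is `y · ∼ y`, which
    -- is 0.
    F⊆kernel : F ⊆ kernel
    F⊆kernel {x} x∈ with simple _ resized-isCongruence
    ... | inj₁ θ⊆≈ = resize (θ⊆≈ (resize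
      ( I.≤⇒≲ (B.x≤1 _)
      , (x , x∈ , B.≈-sym (B.1⇒x≈x (f x))))))
    ... | inj₂ θ-total =
      let y , y∈ , fy≈ = proj₁ (unresize (θ-total B.1# B.0#))
          ∼y∈ = kernel⊆F (resize (B.≈-trans (∼-homo y) (B.∼-cong (B.≈-trans fy≈ (B.1⇒x≈x B.0#)))))
      in contradiction (↑-closed (A.≈⇒≤ (A.x·∼x≈0 y)) (·-closed y∈ ∼y∈)) 0∉

  kernel-maximal : MaximalFilter A.raw
  kernel-maximal = record
    { member = kernel ; isProperFilter = kernel-proper ; maximal = λ F F-proper k⊆F → F⊆kernel F F-proper k⊆F }

-- Representation of tense operators

module Infima {c ℓ} (B : MVAlgebra c ℓ) where
  open MVAlgebra B
  open MVProperties B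

  record IsInfimum {i} {I : Set i} (x : I → Carrier) (m : Carrier) : Set (c ⊔ ℓ ⊔ i) where
    field
      lower-bound : ∀ j → m ≤ x j
      greatest    : ∀ {y} → (∀ j → y ≤ x j) → y ≤ m

  open IsInfimum

  private
    variable
      i : Level
      I : Set i
      x y : I → Carrier
      m n : Carrier

  infimum-mono : IsInfimum x m → IsInfimum y n → (∀ j → x j ≤ y j) → m ≤ n
  infimum-mono inf-x inf-y x≤y = greatest inf-y λ j → ≤-trans (lower-bound inf-x j) (x≤y j)

  infimum-unique : IsInfimum x m → IsInfimum y n → (∀ j → x j ≈ y j) → m ≈ n
  infimum-unique inf-x inf-y x≈y = ≤-antisym
    (infimum-mono inf-x inf-y (≈⇒≤ ∘ x≈y)) (infimum-mono inf-y inf-x (≈⇒≤ ∘ ≈-sym ∘ x≈y))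

  ∧-infimum : IsInfimum x m → IsInfimum y n → IsInfimum (λ j → x j ∧ y j) (m ∧ n)
  ∧-infimum inf-x inf-y = record
    { lower-bound = λ j → ∧-greatest (≤-trans (x∧y≤x _ _) (lower-bound inf-x j))
                                     (≤-trans (x∧y≤y _ _) (lower-bound inf-y j))
    ; greatest    = λ z≤ → ∧-greatest (greatest inf-x λ j → ≤-trans (z≤ j) (x∧y≤x _ _))
                                      (greatest inf-y λ j → ≤-trans (z≤ j) (x∧y≤y _ _))
    }

  ⇒-infimum : ∀ a → IsInfimum x m → IsInfimum (λ j → a ⇒ x j) (a ⇒ m)
  ⇒-infimum a inf-x = record
    { lower-bound = λ j → ⇒-monoʳ-≤ a (lower-bound inf-x j)
    ; greatest    = λ z≤ → residual (greatest inf-x λ j → residual⁻¹ (z≤ j))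
    }

  module _ {s} {S : Set s} (R : S → S → Carrier) where
    -- A relation rather than an operation, because an arbitrary MV-algebra need not have these
    -- infima.
    IsBox : (S → Carrier) → S → Carrier → Set (c ⊔ ℓ ⊔ s)
    IsBox x t = IsInfimum (λ s → R s t ⇒ x s)

    box-∧ : ∀ {x y : S → Carrier} {t m n k} →
            IsBox (λ s → x s ∧ y s) t k → IsBox x t m → IsBox y t n → k ≈ m ∧ n
    box-∧ inf-k inf-m inf-n = infimum-unique inf-k (∧-infimum inf-m inf-n) λ s → ≤-antisym
      (∧-greatest (⇒-monoʳ-≤ _ (x∧y≤x _ _)) (⇒-monoʳ-≤ _ (x∧y≤y _ _))) (⇒-∧-≤ _ _ _)

    box-⇒ : ∀ {x : S → Carrier} {t m k} a → IsBox x t m → IsBox (λ s → a ⇒ x s) t k → (a ⇒ m) ≈ k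
    box-⇒ a inf-m inf-k = infimum-unique (⇒-infimum a inf-m) inf-k λ s → ⇒-swap a _ _

  contrapose : ∀ x y → (x ⇒ y) ≈ (∼ y ⇒ ∼ x)
  contrapose x y = ≈-trans (⊕-comm _ _) (⊕-congʳ (≈-sym (∼-involutive y)))

  -- It suffices that `∼ x t` is a lower bound of the family with infimum `m`. By swapping premises
  -- and contraposing, this becomes `□x s ≤ (R t s ⇒ x t)`, one of the inequalities that define the
  -- box of `x`.
  box-adjoint : ∀ {s} {S : Set s} (R : S → S → Carrier) {x □x : S → Carrier} {t m} →
                (∀ s → IsBox R x s (□x s)) → IsBox (λ s t → R t s) (λ s → ∼ □x s) t m → ∼ m ≤ x t
  box-adjoint R {x} {t = t} isBox inf-m = ∼≤⇒∼≤ (greatest inf-m λ s → ≤⇒-swap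
    (≤-trans (≤⇒-swap (lower-bound (isBox s) t)) (≈⇒≤ (contrapose _ (x t)))))

module Evaluation (em : ∀ {ℓ} → ExcludedMiddle ℓ)
                  {a ℓ b m} {A : RawPavelkaAlgebra a ℓ} (A-isPavelka : IsPavelkaAlgebra A)
                  {B : RawPavelkaAlgebra b m} (B-isPavelka : IsPavelkaAlgebra B)
                  (dense : PavelkaProperties.HasDenseConstants B B-isPavelka)
                  (M : MaximalFilter (RawPavelkaAlgebra.rawMVAlgebra A))
                  {h} (isMono : IsMVMonomorphism
                                  (quotient (RawPavelkaAlgebra.rawMVAlgebra A) (MaximalFilter.member M))
                                  (RawPavelkaAlgebra.rawMVAlgebra B) h) where
  private
    module A where
      open RawPavelkaAlgebra A public
      open PavelkaProperties A A-isPavelka public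
    module B where
      open RawPavelkaAlgebra B public
      open IsPavelkaAlgebra B-isPavelka public
      open IsMVAlgebra isMVAlgebra public using (∼-cong)
      open PavelkaProperties B B-isPavelka public
  open MaximalFilter M renaming (member to F)
  open IsProperFilter isProperFilter
  open FilterProperties A.mvAlgebra isFilter
  open IsMVMonomorphism isMono
  open IsMVHomomorphism isMVHomomorphism

  isHom : IsMVHomomorphism A.rawMVAlgebra B.rawMVAlgebra h
  isHom = record
    { cong   = λ x≈y → cong (≤⇒≲ (A.≈⇒≤ x≈y) , ≤⇒≲ (A.≈⇒≤ (A.≈-sym x≈y)))
    ; ⊕-homo = ⊕-homo
    ; ∼-homo = ∼-homo
    ; 0-homo = 0-homo
    }

  h-⇒ : ∀ x y → h (x A.⇒ y) B.≈ (h x B.⇒ h y)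
  h-⇒ = ⇒-homo A.mvAlgebra B.mvAlgebra isHom

  ≲⇒≤ : ∀ {x y} → x ≲ y → h x B.≤ h y
  ≲⇒≤ {x} {y} x≲y = B.≈-trans (B.≈-sym (h-⇒ x y)) (B.≈-trans
    (cong {x A.⇒ y} {A.1#} (≤⇒≲ (A.x≤1 _) , ∈-resp-≈ (A.≈-sym (A.1⇒x≈x _)) x≲y))
    (1-homo A.mvAlgebra B.mvAlgebra isHom))

  ≤-reflect-≲ : ∀ {x y} → h x B.≤ h y → x ≲ y
  ≤-reflect-≲ {x} {y} hx≤hy = ∈-resp-≈ (A.1⇒x≈x _) (proj₂ (injective {x A.⇒ y} {A.1#}
    (B.≈-trans (h-⇒ x y) (B.≈-trans hx≤hy (B.≈-sym (1-homo A.mvAlgebra B.mvAlgebra isHom))))))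

  h-const : ∀ r → h (A.const r) B.≈ B.const r
  h-const = B.const-unique em dense record
    { mono   = λ r s r≤s → ≲⇒≤ (≤⇒≲ (A.const-mono-≤ r s r≤s))
    ; ⊕-homo = λ r s → B.≈-trans (IsMVHomomorphism.cong isHom (A.≈-sym (A.const-⊕ r s))) (⊕-homo _ _)
    ; ∼-homo = λ r → B.≈-trans (IsMVHomomorphism.cong isHom (A.≈-sym (A.const-∼ r))) (∼-homo _)
    ; 0-homo = 0-homo
    }

module Representation (em : ∀ {ℓ} → ExcludedMiddle ℓ) (zorn : ∀ {c ℓ₁ ℓ₂ p} → Zorn c ℓ₁ ℓ₂ p)
                      {a ℓ b m} {A : RawPavelkaAlgebra a ℓ} (A-isPavelka : IsPavelkaAlgebra A)
                      {B : RawPavelkaAlgebra b m} (B-isPavelka : IsPavelkaAlgebra B)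
                      (dense : PavelkaProperties.HasDenseConstants B B-isPavelka)
                      (h : MaximalFilter (RawPavelkaAlgebra.rawMVAlgebra A) →
                           RawPavelkaAlgebra.Carrier A → RawPavelkaAlgebra.Carrier B)
                      (isMono : ∀ M → IsMVMonomorphism
                                  (quotient (RawPavelkaAlgebra.rawMVAlgebra A) (MaximalFilter.member M))
                                  (RawPavelkaAlgebra.rawMVAlgebra B) (h M)) where
  private
    module A where
      open RawPavelkaAlgebra A public
      open PavelkaProperties A A-isPavelka public
    module B where
      open RawPavelkaAlgebra B public
      open IsPavelkaAlgebra B-isPavelka public
      open IsMVAlgebra isMVAlgebra public using (∼-cong)
      open PavelkaProperties B B-isPavelka public
      open HasDenseConstants dense public
    module Ev M = Evaluation em A-isPavelka B-isPavelka dense M (isMono M)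
    Max = MaximalFilter A.rawMVAlgebra
  open MaximalFilter using (member)
  open Infima B.mvAlgebra
  open IsInfimum

  module _ (G : A.Carrier → A.Carrier) (G-cong : Congruent A._≈_ A._≈_ G)
           (G-∧ : ∀ x y → G (x A.∧ y) A.≈ G x A.∧ G y)
           (G-⇒ : ∀ r x → (A.const r A.⇒ G x) A.≈ G (A.const r A.⇒ x)) where

    -- (PT2) at the constant 0, as `0# ⇒ z` is `1#` for every `z`.
    G-1 : G A.1# A.≈ A.1#
    G-1 = A.≈-trans (G-cong (A.≈-sym (A.0⇒x≈1 A.1#))) (A.≈-trans (A.≈-sym (G-⇒ 0𝕀ℚ A.1#)) (A.0⇒x≈1 (G A.1#)))

    G-mono : ∀ {x y} → x A.≤ y → G x A.≤ G y
    G-mono x≤y = A.≤-trans (A.≈⇒≤ (A.≈-trans (G-cong (A.≈-sym (A.≤⇒∧≈ x≤y))) (G-∧ _ _))) (A.x∧y≤y _ _)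

    module _ (N : Max) where
      open MaximalFilter N using (isProperFilter) renaming (member to F)
      open IsProperFilter isProperFilter
      open FilterProperties A.mvAlgebra isFilter

      -- Prelinearity puts x ⇒ r and the y ⇒ b with G b ∈ F into the filter F₀,
      -- which is proper unless G y ∈ F.

      separating : ∀ r x → G (A.const r A.⇒ x) ∉ F →
        ∃[ M ] h M x B.≤ B.const r × (∀ {b} → G b ∈ F → (B.const r B.⇒ h M x) B.≤ h M b)
      separating r x Gy∉ =
        let M , F₀⊆M = maximalExtension em zorn A.rawMVAlgebra F₀ F₀-proper
            h-y = B.≈-trans (Ev.h-⇒ M (A.const r) x) (B.⊕-congʳ (B.∼-cong (Ev.h-const M r)))
        in M ,
           B.≤-trans (Ev.≲⇒≤ M (F₀⊆M x⇒r∈)) (B.≈⇒≤ (Ev.h-const M r)) ,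
           λ Gb∈ → B.≤-trans (B.≈⇒≤ (B.≈-sym h-y)) (Ev.≲⇒≤ M (F₀⊆M (y⇒b∈ Gb∈)))
        where
        y = A.const r A.⇒ x

        -- A directed union of co-annihilators: for fixed `b`, the `a` whose join with `b ⇒ y` is 1
        -- form a filter, and this filter grows as `b` decreases.
        F₀ : Pred A.Carrier (a ⊔ ℓ)
        F₀ a = ∃[ b ] G b ∈ F × a A.∨ (b A.⇒ y) A.≈ A.1#

        F₀-proper : IsProperFilter A.rawMVAlgebra F₀
        F₀-proper = record
          { isFilter = record
            { 1∈       = A.1# , ∈-resp-≈ (A.≈-sym G-1) 1∈ , A.1≤⇒≈1 (A.x≤x∨y _ _)
            ; ·-closed = λ {u} {v} (b , Gb∈ , u∨) (b′ , Gb′∈ , v∨) →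
                b A.∧ b′ ,
                ∈-resp-≈ (A.≈-sym (G-∧ b b′)) (↑-closed (A.x·y≤x∧y _ _) (·-closed Gb∈ Gb′∈)) ,
                A.1≤⇒≈1 (A.≤-trans
                  (A.≤-trans (A.≈⇒≤ (A.≈-sym (A.·-identityˡ A.1#)))
                    (A.·-mono-≤
                      (A.≤-trans (A.≈⇒≤ (A.≈-sym u∨)) (A.∨-mono-≤ A.≤-refl (A.⇒-antiˡ-≤ y (A.x∧y≤x b b′))))
                      (A.≤-trans (A.≈⇒≤ (A.≈-sym v∨)) (A.∨-mono-≤ A.≤-refl (A.⇒-antiˡ-≤ y (A.x∧y≤y b b′))))))
                  (A.∨-·-≤ _ u v))
            ; ↑-closed = λ u≤v (b , Gb∈ , u∨) →
                b , Gb∈ , A.1≤⇒≈1 (A.≤-trans (A.≈⇒≤ (A.≈-sym u∨)) (A.∨-mono-≤ u≤v A.≤-refl))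
            }
          -- 0 ∨ (b ⇒ y) = 1 means b ≤ y, so monotonicity of `G` would put G y into F.
          ; 0∉ = λ (b , Gb∈ , 0∨) → Gy∉ (↑-closed
              (G-mono (A.1≤⇒≈1 (A.≤-trans (A.≈⇒≤ (A.≈-sym 0∨)) (A.∨-least (A.0≤x _) A.≤-refl)))) Gb∈)
          }

        y⇒b∈ : ∀ {b} → G b ∈ F → (y A.⇒ b) ∈ F₀
        y⇒b∈ {b} Gb∈ = b , Gb∈ , A.prelinearity y b

        x⇒r∈ : (x A.⇒ A.const r) ∈ F₀
        x⇒r∈ = A.1# , ∈-resp-≈ (A.≈-sym G-1) 1∈ , A.1≤⇒≈1 (A.≤-trans
          (A.≈⇒≤ (A.≈-sym (A.prelinearity x (A.const r))))
          (A.∨-mono-≤ A.≤-refl (A.≈⇒≤ (A.≈-sym (A.1⇒x≈x y)))))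

      G-infimum : (ρ : Max → B.Carrier) → (∀ M → IsInfimum (λ a → h N (G a) B.⇒ h M a) (ρ M)) →
                  ∀ x → IsInfimum (λ M → ρ M B.⇒ h M x) (h N (G x))
      G-infimum ρ ρ-infimum x = record
        { lower-bound = λ M → B.≤⇒-swap (lower-bound (ρ-infimum M) x)
        ; greatest    = λ {y} y≤ → by-contradiction λ y≰ →
            let r , s , r<s , s≤y , r≰ = B.dense y≰
                M , x≤r , below = separating r x λ Gy∈ → r≰ (B.≤-trans (B.≈⇒≤ (B.≈-sym (Ev.h-const N r)))
                  (Ev.≲⇒≤ N (∈-resp-≈ (A.≈-sym (G-⇒ r x)) Gy∈)))
            in ℚ.<-irrefl refl (ℚ.<-≤-trans r<s (B.const-reflect-≤ s r
                 (B.≤-trans s≤y (B.≤-trans (y≤ M) (ρ⇒x≤r M r x≤r below)))))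
        }
        where
        open Classical em
        ρ⇒x≤r : ∀ M r → h M x B.≤ B.const r →
                (∀ {b} → G b ∈ F → (B.const r B.⇒ h M x) B.≤ h M b) → (ρ M B.⇒ h M x) B.≤ B.const r
        ρ⇒x≤r M r x≤r below = begin
          ρ M B.⇒ h M x                         ≲⟨ B.⇒-antiˡ-≤ (h M x) r⇒x≤ρ ⟩
          (B.const r B.⇒ h M x) B.⇒ h M x       ≲⟨ B.∨-least B.≤-refl x≤r ⟩
          B.const r                             ∎
          where
          open B.≤-Reasoning
          -- Density reduces the bound to constants `s` below `h N (G a)`. For these, `s ⇒ a` is an
          -- admissible `b` in `below`.
          r⇒x≤ρ : (B.const r B.⇒ h M x) B.≤ ρ M
          r⇒x≤ρ = greatest (ρ-infimum M) λ a → B.≤⇒-swap (by-contradiction λ Ga≰ →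
            let s′ , s , s′<s , s≤Ga , s′≰ = B.dense Ga≰ in
            s′≰ (B.≤-trans (B.const-mono-≤ s′ s (ℚ.<⇒≤ s′<s)) (B.≤⇒-swap (B.≤-trans
              (below (∈-resp-≈ (G-⇒ s a) (Ev.≤-reflect-≲ N (B.≤-trans (B.≈⇒≤ (Ev.h-const N s)) s≤Ga))))
              (B.≈⇒≤ (B.≈-trans (Ev.h-⇒ M (A.const s) a) (B.⊕-congʳ (B.∼-cong (Ev.h-const M s)))))))))

  -- The given bound at `∼ H a`, after contraposition, has the conclusion `h N (∼ G (∼ H a))`, which
  -- (PT3) puts below `h N a`.
  conjugate-lower-bound : ∀ (G H : A.Carrier → A.Carrier) → (∀ x → A.∼ G (A.∼ H x) A.≤ x) → ∀ M N {z} →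
                          (∀ a → z B.≤ (h N (G a) B.⇒ h M a)) → ∀ a → z B.≤ (h M (H a) B.⇒ h N a)
  conjugate-lower-bound G H ∼G∼H≤ M N {z} z≤ a = begin
    z                                                  ≲⟨ z≤ (A.∼ H a) ⟩
    h N (G (A.∼ H a)) B.⇒ h M (A.∼ H a)                ≈⟨ B.⊕-congˡ (∼-homo M (H a)) ⟩
    h N (G (A.∼ H a)) B.⇒ B.∼ h M (H a)                ≈⟨ B.⊕-comm _ _ ⟩
    h M (H a) B.⇒ B.∼ h N (G (A.∼ H a))                ≈⟨ B.⊕-congˡ (∼-homo N _) ⟨
    h M (H a) B.⇒ h N (A.∼ G (A.∼ H a))                ≲⟨ B.⇒-monoʳ-≤ _ (Ev.≲⇒≤ N (≤⇒≲ N (∼G∼H≤ a))) ⟩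
    h M (H a) B.⇒ h N a                                ∎
    where
    open B.≤-Reasoning
    ∼-homo : ∀ M x → h M (A.∼ x) B.≈ B.∼ h M x
    ∼-homo M = IsMVHomomorphism.∼-homo (Ev.isHom M)
    ≤⇒≲ : ∀ N {x y} → x A.≤ y → (x A.⇒ y) ∈ member N
    ≤⇒≲ N = FilterProperties.≤⇒≲ A.mvAlgebra (IsProperFilter.isFilter (MaximalFilter.isProperFilter N))

  -- By the two halves of (PT3) both families have the same lower bounds.
  conjugate-infimum : ∀ (G H : A.Carrier → A.Carrier) →
                      (∀ x → A.∼ G (A.∼ H x) A.≤ x) → (∀ x → A.∼ H (A.∼ G x) A.≤ x) → ∀ M N {ρ} →
                      IsInfimum (λ a → h N (G a) B.⇒ h M a) ρ → IsInfimum (λ a → h M (H a) B.⇒ h N a) ρ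
  conjugate-infimum G H ∼G∼H≤ ∼H∼G≤ M N inf = record
    { lower-bound = conjugate-lower-bound G H ∼G∼H≤ M N (lower-bound inf)
    ; greatest    = λ z≤ → greatest inf (conjugate-lower-bound H G ∼H∼G≤ N M z≤)
    }

  -- The infima are unbundled here: with B = [0,1], comparing them as parameters
  -- of IsInfimum would mean comparing the proofs inside Dedekind cuts.

  module Adjunction (G H : A.Carrier → A.Carrier)
                    (G-cong : Congruent A._≈_ A._≈_ G) (H-cong : Congruent A._≈_ A._≈_ H)
                    (G-∧ : ∀ x y → G (x A.∧ y) A.≈ G x A.∧ G y) (H-∧ : ∀ x y → H (x A.∧ y) A.≈ H x A.∧ H y)
                    (G-⇒ : ∀ r x → (A.const r A.⇒ G x) A.≈ G (A.const r A.⇒ x))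
                    (H-⇒ : ∀ r x → (A.const r A.⇒ H x) A.≈ H (A.const r A.⇒ x))
                    (∼H∼G≤ : ∀ x → A.∼ H (A.∼ G x) A.≤ x) (∼G∼H≤ : ∀ x → A.∼ G (A.∼ H x) A.≤ x)
                    (R : Max → Max → B.Carrier)
                    (R-lower : ∀ M N a → R M N B.≤ (h N (G a) B.⇒ h M a))
                    (R-greatest : ∀ M N {z} → (∀ a → z B.≤ (h N (G a) B.⇒ h M a)) → z B.≤ R M N) where
    private
      R-infimum : ∀ M N → IsInfimum (λ a → h N (G a) B.⇒ h M a) (R M N)
      R-infimum M N = record { lower-bound = R-lower M N ; greatest = R-greatest M N }

      G-box : ∀ N x → IsInfimum (λ M → R M N B.⇒ h M x) (h N (G x))
      G-box N = G-infimum G G-cong G-∧ G-⇒ N (λ M → R M N) (λ M → R-infimum M N)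

      H-box : ∀ N x → IsInfimum (λ M → R N M B.⇒ h M x) (h N (H x))
      H-box N = G-infimum H H-cong H-∧ H-⇒ N (λ M → R N M)
        (λ M → conjugate-infimum G H ∼G∼H≤ ∼H∼G≤ N M (R-infimum N M))

    G-lower : ∀ x N M → h N (G x) B.≤ (R M N B.⇒ h M x)
    G-lower x N = lower-bound (G-box N x)

    G-greatest : ∀ x N {z} → (∀ M → z B.≤ (R M N B.⇒ h M x)) → z B.≤ h N (G x)
    G-greatest x N = greatest (G-box N x)

    H-lower : ∀ x N M → h N (H x) B.≤ (R N M B.⇒ h M x)
    H-lower x N = lower-bound (H-box N x)

    H-greatest : ∀ x N {z} → (∀ M → z B.≤ (R N M B.⇒ h M x)) → z B.≤ h N (H x)
    H-greatest x N = greatest (H-box N x)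

-- The tense Pavelka algebra of a time frame

module StandardTense (em : ∀ {ℓ} → ExcludedMiddle ℓ) where
  open Classical em
  open UnitInterval

  module 𝕊 (u : Level) where
    open PavelkaProperties (standard u) isPavelkaAlgebraᴵ public
    open Infima mvAlgebra public

  isInfimumᴵ : ∀ {i u} {I : Set i} (x : I → 𝕀 u) m → (∀ j → m ≤ᴵ x j) →
               (∀ y → (∀ j → y ≤ᴵ x j) → y ≤ᴵ m) → 𝕊.IsInfimum u x m
  isInfimumᴵ x m lower greatest = record
    { lower-bound = λ j → ≤ᴵ⇒∼⊕≈1 m (x j) (lower j)
    ; greatest    = λ {y} y≤x → ≤ᴵ⇒∼⊕≈1 y m (greatest y λ j → ∼⊕≈1⇒≤ᴵ y (x j) (y≤x j))
    }

  power-isPavelkaAlgebra : ∀ {t t′} (T : Setoid t t′) u → IsPavelkaAlgebra (power T u)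
  power-isPavelkaAlgebra T u = record
    { isMVAlgebra = record
      { ⊕-isCommutativeMonoid = record
        { isMonoid = record
          { isSemigroup = record
            { isMagma = record
              { isEquivalence = record
                { refl  = λ _ → id , id
                ; sym   = λ x≈y t → proj₂ (x≈y t) , proj₁ (x≈y t)
                ; trans = λ x≈y y≈z t → proj₁ (y≈z t) ∘ proj₁ (x≈y t) , proj₂ (x≈y t) ∘ proj₂ (y≈z t)
                }
              ; ∙-cong = λ {x} {y} {z} {w} x≈y z≈w t →
                  ⊕ᴵ-cong {x = x ⟨$⟩ t} {y ⟨$⟩ t} {z ⟨$⟩ t} {w ⟨$⟩ t} (x≈y t) (z≈w t)
              }
            ; assoc = λ x y z t → ⊕ᴵ-assoc (x ⟨$⟩ t) (y ⟨$⟩ t) (z ⟨$⟩ t)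
            }
          ; identity = (λ x t → ⊕ᴵ-identityˡ (x ⟨$⟩ t)) , (λ x t → ⊕ᴵ-identityʳ (x ⟨$⟩ t))
          }
        ; comm = λ x y t → ⊕ᴵ-comm-≤ (x ⟨$⟩ t) (y ⟨$⟩ t) , ⊕ᴵ-comm-≤ (y ⟨$⟩ t) (x ⟨$⟩ t)
        }
      ; ∼-cong       = λ {x} {y} x≈y t → ∼ᴵ-cong {x = x ⟨$⟩ t} {y ⟨$⟩ t} (x≈y t)
      ; ∼-involutive = λ x t → ∼ᴵ-involutive (x ⟨$⟩ t)
      ; ⊕-zeroʳ      = λ x t → ⊕ᴵ-zeroʳ (x ⟨$⟩ t)
      ; łukasiewicz  = λ x y t → łukasiewiczᴵ (x ⟨$⟩ t) (y ⟨$⟩ t)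
      }
    ; ⊕-const = λ r s t r+s≡t _ → ⊕-constᴵ r s t r+s≡t
    ; ∼-const = λ r s 1-r≡s _ → ∼-constᴵ r s 1-r≡s
    }

  module _ {t t′} (𝓕 : TimeFrame t t′) where
    open TimeFrame 𝓕
    open RawPavelkaAlgebra (standard t) using (_⇒_; _∧_)
    private
      module P = RawPavelkaAlgebra (power T t)
      S = Setoid.Carrier T

    box : ∀ (x : P.Carrier) v → 𝕊.IsBox t R (x ⟨$⟩_) v (f 𝓕 x ⟨$⟩ v)
    box x v = isInfimumᴵ (λ s → R s v ⇒ (x ⟨$⟩ s)) (f 𝓕 x ⟨$⟩ v)
      (λ s → ⋀-lower {u = t} (λ s → R s v ⇒ (x ⟨$⟩ s)) s)
      (⋀-greatest {u = t} (λ s → R s v ⇒ (x ⟨$⟩ s)))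

    f-cong : ∀ {x y} → x P.≈ y → f 𝓕 x P.≈ f 𝓕 y
    f-cong {x} {y} x≈y v =
      ⋀-cong {u = t} (λ s → R s v ⇒ (x ⟨$⟩ s)) (λ s → R s v ⇒ (y ⟨$⟩ s)) λ s →
      ⊕ᴵ-cong {x = ∼ᴵ R s v} {∼ᴵ R s v} {x ⟨$⟩ s} {y ⟨$⟩ s} (id , id) (x≈y s)

    f-∧ : ∀ x y → f 𝓕 (x P.∧ y) P.≈ (f 𝓕 x P.∧ f 𝓕 y)
    f-∧ x y v = 𝕊.box-∧ t R {x ⟨$⟩_} {y ⟨$⟩_} {v} {f 𝓕 x ⟨$⟩ v} {f 𝓕 y ⟨$⟩ v} {f 𝓕 (x P.∧ y) ⟨$⟩ v}
      (box (x P.∧ y) v) (box x v) (box y v)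

    f-⇒ : ∀ r x → (P.const r P.⇒ f 𝓕 x) P.≈ f 𝓕 (P.const r P.⇒ x)
    f-⇒ r x v = 𝕊.box-⇒ t R {x ⟨$⟩_} {v} {f 𝓕 x ⟨$⟩ v} {f 𝓕 (P.const r P.⇒ x) ⟨$⟩ v}
      (constᴵ r) (box x v) (box (P.const r P.⇒ x) v)

  f-adjoint : ∀ {t t′} (𝓕 : TimeFrame t t′) x →
              let open RawPavelkaAlgebra (power (TimeFrame.T 𝓕) t) in
              ∼ f (converse 𝓕) (∼ f 𝓕 x) ≤ x
  f-adjoint {t} 𝓕 x v = 𝕊.box-adjoint t (TimeFrame.R 𝓕)
    {x ⟨$⟩_} {f 𝓕 x ⟨$⟩_} {v} {f (converse 𝓕) (∼ f 𝓕 x) ⟨$⟩ v}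
    (box 𝓕 x) (box (converse 𝓕) (∼ f 𝓕 x) v)
    where open RawPavelkaAlgebra (power (TimeFrame.T 𝓕) t)

  induced-isTensePavelkaAlgebra : ∀ {t t′} (𝓕 : TimeFrame t t′) → IsTensePavelkaAlgebra (induced 𝓕)
  induced-isTensePavelkaAlgebra {t} 𝓕 = record
    { isPavelkaAlgebra = power-isPavelkaAlgebra (TimeFrame.T 𝓕) t
    ; G-cong = λ {x} {y} → f-cong 𝓕 {x} {y}
    ; H-cong = λ {x} {y} → f-cong (converse 𝓕) {x} {y}
    ; G-∧    = f-∧ 𝓕
    ; H-∧    = f-∧ (converse 𝓕)
    ; G-⇒    = f-⇒ 𝓕
    ; H-⇒    = f-⇒ (converse 𝓕)
    ; ∼H∼G≤  = f-adjoint 𝓕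
    ; ∼G∼H≤  = f-adjoint (converse 𝓕)
    }

-- The natural embedding of a semisimple tense Pavelka algebra

module NaturalEmbedding (em : ∀ {ℓ} → ExcludedMiddle ℓ) (zorn : ∀ {c ℓ₁ ℓ₂ p} → Zorn c ℓ₁ ℓ₂ p)
                        {c ℓ} (𝐀 : TensePavelkaAlgebra c ℓ)
                        (q : QuotientEmbeddings (TensePavelkaAlgebra.rawMVAlgebra 𝐀)) where
  open TensePavelkaAlgebra 𝐀
  open QuotientEmbeddings q
  open Classical em
  open UnitInterval
  open StandardTense em
  private
    u = suc (c ⊔ ℓ)

  -- Rebuilt from its fields for the same reason as the unbundled infima above.

  /-isMono : ∀ M → IsMVMonomorphism (quotient rawMVAlgebra (MaximalFilter.member M))
                     (RawPavelkaAlgebra.rawMVAlgebra (standard u)) (_/ M)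
  /-isMono M = record
    { isMVHomomorphism = record
      { cong = Hom.cong ; ⊕-homo = Hom.⊕-homo ; ∼-homo = Hom.∼-homo ; 0-homo = Hom.0-homo }
    ; injective = Mono.injective
    }
    where
    module Mono = IsMVMonomorphism (isEmbedding M)
    module Hom  = IsMVHomomorphism Mono.isMVHomomorphism

  private
    module Ev = Evaluation em {A = rawPavelkaAlgebra} isPavelkaAlgebra {B = standard u} (isPavelkaAlgebraᴵ {u})
                  (StandardProperties.hasDenseConstants em u)
    module Rep = Representation em zorn {A = rawPavelkaAlgebra} isPavelkaAlgebra {B = standard u} (isPavelkaAlgebraᴵ {u})
                   (StandardProperties.hasDenseConstants em u) (λ M x → x / M) /-isMono
    module 𝕌 = RawPavelkaAlgebra (standard u)
    Max = MaximalFilter rawMVAlgebra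
  open TimeFrame (canonicalFrame 𝐀 q) using (R)

  -- The kernel of each projection onto a simple factor is a maximal filter, so equality modulo all
  -- maximal filters gives equality in every factor.
  natural-injective : ∀ {i s sℓ} → Semisimple mvAlgebra i s sℓ →
                      ∀ {x y} → (∀ M → x / M ≈ᴵ y / M) → x ≈ y
  natural-injective (S , simple) {x} {y} x≈y = jointly-monic λ j →
    MVProperties.≤-antisym (factor j)
      (proj-≤ j x y (proj₁ (x≈y (K.kernel-maximal j))))
      (proj-≤ j y x (proj₂ (x≈y (K.kernel-maximal j))))
    where
    open SubdirectRepresentation S

    preimage : ∀ j b → ∃[ a ] MVAlgebra._≈_ (factor j) (proj j a) b
    preimage j b = let a , fa≈b = surjective j b in a , fa≈b (MVProperties.≈-refl mvAlgebra)

    module K j = SimpleQuotient em mvAlgebra (factor j) (proj-isHom j) (preimage j) (simple j)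

    proj-≤ : ∀ j x y → x / K.kernel-maximal j ≤ᴵ y / K.kernel-maximal j →
             MVAlgebra._≤_ (factor j) (proj j x) (proj j y)
    proj-≤ j x y x≤y = K.∈kernel⇒f≤ j (Ev.≤-reflect-≲ M (/-isMono M) (≤ᴵ⇒∼⊕≈1 (x / M) (y / M) x≤y))
      where M = K.kernel-maximal j

  private
    quotients : Max → Max → Carrier → 𝕀 u
    quotients M N a = G a / N 𝕌.⇒ a / M

    module Box = Rep.Adjunction G H G-cong H-cong G-∧ H-∧ G-⇒ H-⇒ ∼H∼G≤ ∼G∼H≤ R
      (λ M N a → ≤ᴵ⇒∼⊕≈1 (R M N) (quotients M N a) (⋀-lower {u = u} (quotients M N) a))
      (λ M N {z} z≤ → ≤ᴵ⇒∼⊕≈1 z (R M N)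
        (⋀-greatest {u = u} (quotients M N) z λ a → ∼⊕≈1⇒≤ᴵ z (quotients M N a) (z≤ a)))

  natural-G : ∀ x N → G x / N ≈ᴵ f (canonicalFrame 𝐀 q) (natural 𝐀 q x) ⟨$⟩ N
  natural-G x N =
    ⋀-greatest {u = u} y (G x / N) (λ M → ∼⊕≈1⇒≤ᴵ (G x / N) (y M) (Box.G-lower x N M)) ,
    ∼⊕≈1⇒≤ᴵ (⋀ {u = u} y) (G x / N)
      (Box.G-greatest x N {⋀ {u = u} y} λ M → ≤ᴵ⇒∼⊕≈1 (⋀ {u = u} y) (y M) (⋀-lower {u = u} y M))
    where
    y : Max → 𝕀 u
    y M = R M N 𝕌.⇒ x / M

  natural-H : ∀ x N → H x / N ≈ᴵ f (converse (canonicalFrame 𝐀 q)) (natural 𝐀 q x) ⟨$⟩ N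
  natural-H x N =
    ⋀-greatest {u = u} y (H x / N) (λ M → ∼⊕≈1⇒≤ᴵ (H x / N) (y M) (Box.H-lower x N M)) ,
    ∼⊕≈1⇒≤ᴵ (⋀ {u = u} y) (H x / N)
      (Box.H-greatest x N {⋀ {u = u} y} λ M → ≤ᴵ⇒∼⊕≈1 (⋀ {u = u} y) (y M) (⋀-lower {u = u} y M))
    where
    y : Max → 𝕀 u
    y M = R N M 𝕌.⇒ x / M

  natural-isEmbedding : ∀ {i s sℓ} → Semisimple mvAlgebra i s sℓ →
                        IsTensePavelkaEmbedding raw (induced (canonicalFrame 𝐀 q)) (natural 𝐀 q)
  natural-isEmbedding semisimple = record
    { isPavelkaHomomorphism = record
      { cong       = λ {x} {y} x≈y M → IsMVHomomorphism.cong (Ev.isHom M (/-isMono M)) {x} {y} x≈y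
      ; ⊕-homo     = λ x y M → IsMVHomomorphism.⊕-homo (Ev.isHom M (/-isMono M)) x y
      ; ∼-homo     = λ x M → IsMVHomomorphism.∼-homo (Ev.isHom M (/-isMono M)) x
      ; const-homo = λ r M → Ev.h-const M (/-isMono M) r
      }
    ; injective = natural-injective semisimple
    ; G-homo    = natural-G
    ; H-homo    = natural-H
    }

theorem11 : (∀ {ℓ} → ExcludedMiddle ℓ) →
    (∀ {c ℓ₁ ℓ₂ p} → Zorn c ℓ₁ ℓ₂ p) →
    ∀ {t t′ c ℓ i s sℓ} →
    ((𝓕 : TimeFrame t t′) → IsTensePavelkaAlgebra (induced 𝓕))
    ×
    ((𝐀 : TensePavelkaAlgebra c ℓ) →
    Semisimple (TensePavelkaAlgebra.mvAlgebra 𝐀) i s sℓ →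
    QuotientEmbeddings (TensePavelkaAlgebra.rawMVAlgebra 𝐀)
    ×
    ((q : QuotientEmbeddings (TensePavelkaAlgebra.rawMVAlgebra 𝐀)) →
    IsTensePavelkaEmbedding (TensePavelkaAlgebra.raw 𝐀) (induced (canonicalFrame 𝐀 q)) (natural 𝐀 q)))
theorem11 em zorn =
  StandardTense.induced-isTensePavelkaAlgebra em ,
  λ 𝐀 semisimple →
    CanonicalEmbedding.quotientEmbeddings em (TensePavelkaAlgebra.rawPavelkaAlgebra 𝐀)
      (TensePavelkaAlgebra.isPavelkaAlgebra 𝐀) ,
    λ q → NaturalEmbedding.natural-isEmbedding em zorn 𝐀 q semisimple
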